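{- Let $s\ge 2$ and $e_1,\dots,e_s\ge2$ be integers, $v:=\prod_{i=1}^s e_i$, $d:=\gcd(e_1-1,\dots,e_s-1)$, and let $k$ be an integer with $1<k<v$. Let $y_0:=1$ and, for $1\le i\le s$, $y_i:=1+\frac{k-1}{v-1}\left(\left(\prod_{j=1}^i e_j\right)-1\right)$. Assume that $v-1$ divides $(k-1)d$ and that, for each $i\in\{1,\dots,s-1\}$, $y_i$ is an integer dividing $(e_{i+1}-1)\left(\prod_{j=1}^i e_j\right)/d$. Let $\mathscr{P}=\prod_{i=1}^s\mathbb{Z}_{e_i}$, let $G=S_{e_1}\wr\cdots\wr S_{e_s}$ be the stabiliser in $\mathrm{Sym}(\mathscr{P})$ of the chain of partitions $\mathscr{C}_0\prec\cdots\prec\mathscr{C}_s$ of $\mathscr{P}$ described in the context, let $$B=\left\{(\delta_1,\dots,\delta_s)\in\mathscr{P} : 0\le\delta_i\le\frac{y_i}{y_{i-1}}-1\text{ for }1\le i\le s\right\},$$ and let $\mathscr{D}=(\mathscr{P},B^G)$, where $B^G=\{B^g : g\in G\}$. Then: (a) $|B|=k$; and (b) $\mathscr{D}$ is a $G$-flag-transitive, $(G,s)$-chain-imprimitive $2$-$(v,k,\lambda)$ design, with $\lambda=\frac{bk(k-1)}{v(v-1)}$, where $b=\prod_{j=1}^s\binom{e_j}{y_j/y_{j-1}}^{k/y_j}$.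
   Context: $\mathbb{Z}_e=\{0,1,\dots,e-1\}$. For $0\le i\le s$, $\mathscr{C}_i$ is the partition of $\mathscr{P}=\prod_{i=1}^s\mathbb{Z}_{e_i}$ in which two points lie in the same class iff their $j$-th coordinates agree for all $j>i$; so $\mathscr{C}_0$ is the partition into singletons, $\mathscr{C}_s=\{\mathscr{P}\}$, and each $\mathscr{C}_i$-class is a union of $e_i$ $\mathscr{C}_{i-1}$-classes. $S_{e_1}\wr\cdots\wr S_{e_s}$ (iterated wreath product) denotes the group of all permutations of $\mathscr{P}$ leaving invariant each of the partitions $\mathscr{C}_0,\dots,\mathscr{C}_s$. A $2$-$(v,k,\lambda)$ design is a pair $(\mathscr{P},\mathscr{B})$ with $|\mathscr{P}|=v$, $\mathscr{B}$ a nonempty set of $k$-subsets of $\mathscr{P}$ (blocks), such that any two distinct points lie in exactly $\lambda$ blocks. It is $G$-flag-transitive if $G$ is a group of automorphisms transitive on the flags, i.e. pairs $(\delta,B)$ with $\delta\in B\in\mathscr{B}$. It is $(G,s)$-chain-imprimitive if $G$ is a group of automorphisms which is transitive on $\mathscr{P}$ and leaves invariant each partition of the chain $\mathscr{C}_0\prec\cdots\prec\mathscr{C}_s$. -}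

module Defs where

import Level
open import Level using (0ℓ)
open import Data.Nat as ℕ using (ℕ; zero; suc; _∸_; _^_; _≤_; _<_; s≤s; z≤n)
import Data.Nat.Properties as ℕₚ
open import Data.Nat.Combinatorics using (_C_)
open import Data.Nat.GCD using (gcd; gcd[m,n]≢0)
open import Data.Nat.ListAction using (product)
open import Data.Integer as ℤ using (ℤ; +_)
import Data.Integer.Divisibility as ℤ
open import Data.Rational as ℚ using (ℚ; 1ℚ; _/_; _÷_)
import Data.Rational.Properties as ℚₚ
open import Data.Fin using (Fin; zero; suc; toℕ)
import Data.List as List
open import Data.Vec using (Vec; []; _∷_; toList; lookup; map; foldr′)
open import Data.Vec.Relation.Unary.All using (All; []; _∷_)
open import Data.Vec.Relation.Unary.All.Properties using (lookup⁺)
open import Data.Product using (Σ; ∃; ∃-syntax; _×_; proj₁; _,_)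
open import Data.Sum using (inj₁)
open import Function.Bundles using (Inverse; _↔_; _⇔_)
open import Function.Construct.Identity using (↔-id)
open import Function.Construct.Composition using (_↔-∘_)
open import Function.Construct.Symmetry using (↔-sym)
open import Relation.Binary using (Rel; Setoid)
open import Relation.Binary.Construct.On as On using ()
open import Relation.Binary.PropositionalEquality using (_≡_; _≢_; setoid)
open import Relation.Unary using (Pred; _∈_; _≐_; U)
open import Relation.Unary.Relation.Binary.Equality using (≐-setoid)

-- The number of elements of S satisfying X, counted up to the equality of S,
-- is n.  The proofs of membership in X are not counted.
HasCardinality : ∀ {a ℓ p} (S : Setoid a ℓ) → Pred (Setoid.Carrier S) p → ℕ → Set (a Level.⊔ ℓ Level.⊔ p)
HasCardinality S X n =
  Inverse (On.setoid {B = ∃ X} S proj₁) (setoid (Fin n))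

module _ (P : Set) where

  Subset : Set₁
  Subset = Pred P 0ℓ

  Sym : Set
  Sym = P ↔ P

module _ {P : Set} where

  infixr 9 _·_
  infixl 8 _^ˢ_ _^ᴳ_

  _·_ : Sym P → P → P
  _·_ = Inverse.to

  _^ˢ_ : Subset P → Sym P → Subset P
  (X ^ˢ g) p = ∃[ q ] q ∈ X × g · q ≡ p

  _^ᴳ_ : Subset P → Pred (Sym P) 0ℓ → Pred (Subset P) 0ℓ
  (X ^ᴳ G) Y = ∃[ g ] g ∈ G × Y ≐ X ^ˢ g

  -- Permutations are identified when they agree pointwise, since intensional
  -- equality of elements of P ↔ P is finer than equality of permutations.
  record IsPermutationGroup (G : Pred (Sym P) 0ℓ) : Set where
    field
      respects : ∀ {g h} → (∀ p → g · p ≡ h · p) → g ∈ G → h ∈ G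
      identity : ↔-id P ∈ G
      compose  : ∀ {g h} → g ∈ G → h ∈ G → (g ↔-∘ h) ∈ G
      inverse  : ∀ {g} → g ∈ G → ↔-sym g ∈ G

  Preserves : Sym P → Rel P 0ℓ → Set
  Preserves g _~_ = ∀ p q → (p ~ q) ⇔ ((g · p) ~ (g · q))

  IsAutomorphism : Pred (Subset P) 0ℓ → Sym P → Set₁
  IsAutomorphism 𝓑 g = ∀ X → (X ∈ 𝓑) ⇔ (X ^ˢ g ∈ 𝓑)

  record IsAutomorphismGroup (G : Pred (Sym P) 0ℓ) (𝓑 : Pred (Subset P) 0ℓ) : Set₁ where
    field
      isGroup        : IsPermutationGroup G
      isAutomorphism : ∀ {g} → g ∈ G → IsAutomorphism 𝓑 g

  -- (P , 𝓑) is a 2-(v, k, Λ) design.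
  record Is2Design (v k Λ : ℕ) (𝓑 : Pred (Subset P) 0ℓ) : Set₁ where
    field
      respects  : ∀ {X Y} → X ≐ Y → X ∈ 𝓑 → Y ∈ 𝓑
      points    : HasCardinality (setoid P) U v
      nonempty  : ∃[ X ] X ∈ 𝓑
      blockSize : ∀ {X} → X ∈ 𝓑 → HasCardinality (setoid P) X k
      balanced  : ∀ {p q} → p ≢ q →
                  HasCardinality (≐-setoid P 0ℓ) (λ X → X ∈ 𝓑 × p ∈ X × q ∈ X) Λ

  record IsFlagTransitive (G : Pred (Sym P) 0ℓ) (𝓑 : Pred (Subset P) 0ℓ) : Set₁ where
    field
      isAutomorphismGroup : IsAutomorphismGroup G 𝓑
      transitive : ∀ {p q X Y} → X ∈ 𝓑 → p ∈ X → Y ∈ 𝓑 → q ∈ Y →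
                   ∃[ g ] g ∈ G × g · p ≡ q × X ^ˢ g ≐ Y

  record IsChainImprimitive (G : Pred (Sym P) 0ℓ) {s : ℕ} (𝒞 : Fin (suc s) → Rel P 0ℓ)
                            (𝓑 : Pred (Subset P) 0ℓ) : Set₁ where
    field
      isAutomorphismGroup : IsAutomorphismGroup G 𝓑
      transitive : ∀ p q → ∃[ g ] g ∈ G × g · p ≡ q
      invariant  : ∀ {g} → g ∈ G → ∀ i → Preserves g (𝒞 i)

-- The index j : Fin s stands for the j+1-st coordinate, so that
-- "agree in all coordinates after the i-th" reads i ≤ toℕ j.
module Chain {s : ℕ} (e : Vec ℕ s) where

  Point : Set
  Point = All Fin e

  𝒞 : Fin (suc s) → Rel Point 0ℓ
  𝒞 i δ ε = ∀ j → toℕ i ≤ toℕ j → lookup⁺ δ j ≡ lookup⁺ ε j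

  Wreath : Pred (Sym Point) 0ℓ
  Wreath g = ∀ i → Preserves g (𝒞 i)

  -- e₁ ⋯ eᵢ
  prefix : ℕ → ℕ
  prefix i = product (List.take i (toList e))

  v : ℕ
  v = product (toList e)

  d : ℕ
  d = foldr′ gcd 0 (map (_∸ 1) e)

_IsIntegerDividing_ : ℚ → ℕ → Set
q IsIntegerDividing n = ∃[ z ] q ≡ z / 1 × z ℤ.∣ + n

module Construction {s : ℕ} (e : Vec ℕ s) (k : ℕ)
  (2≤s : 2 ≤ s) (2≤e : All (2 ≤_) e) (1<k : 1 < k) (k<v : k < Chain.v e) where

  open Chain e public

  instance
    v-1≢0 : ℕ.NonZero (v ∸ 1)
    v-1≢0 = ℕ.>-nonZero (ℕₚ.m<n⇒0<n∸m (ℕₚ.<-trans 1<k k<v))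

    v[v-1]≢0 : ℕ.NonZero (v ℕ.* (v ∸ 1))
    v[v-1]≢0 = ℕₚ.m*n≢0 v (v ∸ 1)
      where instance
        v≢0 : ℕ.NonZero v
        v≢0 = ℕ.>-nonZero (ℕₚ.≤-<-trans z≤n k<v)

    d≢0 : ℕ.NonZero d
    d≢0 = nonZero 2≤s 2≤e
      where
      nonZero : ∀ {n} {es : Vec ℕ n} → 2 ≤ n → All (2 ≤_) es →
                ℕ.NonZero (Chain.d es)
      nonZero {es = suc (suc m) ∷ es} _ (s≤s (s≤s _) ∷ _) =
        ℕ.≢-nonZero (gcd[m,n]≢0 (suc m) (Chain.d es) (inj₁ λ ()))

  -- The subtractions below are exact, as k, v and all prefix products are
  -- positive.
  y : ℕ → ℚ
  y zero    = 1ℚ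
  y (suc i) = 1ℚ ℚ.+ (+ (k ∸ 1) / (v ∸ 1)) ℚ.* (+ (prefix (suc i) ∸ 1) / 1)

  y≢0 : ∀ i → ℚ.NonZero (y i)
  y≢0 zero    = _
  y≢0 (suc i) = ℚₚ.pos⇒nonZero (y (suc i)) {{ℚₚ.pos+nonNeg⇒pos 1ℚ (p ℚ.* q)
                  {{ℚₚ.nonNeg*nonNeg⇒nonNeg p {{ℚₚ.normalize-nonNeg (k ∸ 1) (v ∸ 1)}}
                                            q {{ℚₚ.normalize-nonNeg (prefix (suc i) ∸ 1) 1}}}}}}
    where
    p q : ℚ
    p = + (k ∸ 1) / (v ∸ 1)
    q = + (prefix (suc i) ∸ 1) / 1

  -- yⱼ / yⱼ₋₁
  ratio : Fin s → ℚ
  ratio j = (y (suc (toℕ j)) ÷ y (toℕ j)) {{y≢0 (toℕ j)}}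

  -- k / yⱼ
  coratio : Fin s → ℚ
  coratio j = (+ k / 1 ÷ y (suc (toℕ j))) {{y≢0 (suc (toℕ j))}}

  B : Subset Point
  B δ = ∀ j → + toℕ (lookup⁺ δ j) / 1 ℚ.≤ ratio j ℚ.- 1ℚ

  -- b = ∏ⱼ (eⱼ choose yⱼ/yⱼ₋₁)^(k/yⱼ); this includes that the quotients are
  -- natural numbers, without which the formula would be meaningless.
  BlockFormula : ℕ → Set
  BlockFormula b =
    Σ (Fin s → ℕ) λ m → Σ (Fin s → ℕ) λ n →
      (∀ j → ratio j ≡ + m j / 1) ×
      (∀ j → coratio j ≡ + n j / 1) ×
      b ≡ product (List.tabulate λ j → (lookup e j C m j) ^ n j)

{-# OPTIONS --safe #-}
-- A block meets every class of 𝒞ᵢ either not at all or in yᵢ points: it is obtained by choosing, from the last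
-- coordinate down, mⱼ = yⱼ / yⱼ₋₁ of the eⱼ parts of every class already chosen.  Recursion on e goes the other
-- way and labels the chosen values of a coordinate with the choices made at the earlier ones.  Wreath acts
-- transitively on the flags of the resulting trees, so they enumerate the orbit of B, and counting them gives b.
-- If i is the last coordinate in which p and q differ, the same recursion counts the trees containing both as
-- b (k / v) (yᵢ - yᵢ₋₁) / (e₁⋯eᵢ - e₁⋯eᵢ₋₁).  As yᵢ is an affine function of e₁⋯eᵢ with slope (k - 1) / (v - 1),
-- this does not depend on i.
module Submission where

open import Defs
open import Data.Nat using (ℕ; _∸_; _*_; _≤_; _<_; _/_)
open import Data.Nat.Divisibility using (_∣_)
open import Data.Integer using (+_)
open import Data.Rational using () renaming (_/_ to _/ℚ_)
open import Data.Fin using (Fin; toℕ)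
open import Data.Vec using (Vec; lookup)
open import Data.Vec.Relation.Unary.All using (All)
open import Data.Product using (_×_; ∃-syntax)
open import Relation.Binary.PropositionalEquality using (_≡_; setoid)

import Algebra.Properties.CommutativeMonoid.Sum
open import Data.Bool using (Bool; true; false)
open import Data.Empty using (⊥; ⊥-elim)
open import Data.Fin using (zero; suc; fromℕ<; inject≤; combine; remQuot; _≟_)
open import Data.Fin.Permutation as Perm using (Permutation′; _⟨$⟩ʳ_; _⟨$⟩ˡ_; transpose)
import Data.Fin.Properties as Finₚ
open import Data.Integer as ℤ using (-[1+_]; ∣_∣; +≤+)
import Data.Integer.Properties as ℤₚ
open import Data.List using (tabulate)
open import Data.Maybe as Maybe using (Maybe; just; nothing; maybe′; is-just; _>>=_)
open import Data.Maybe.Properties using (just-injective)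
open import Data.Nat using (zero; suc; _+_; _^_; z≤n; s≤s; NonZero; >-nonZero)
open import Data.Nat.Combinatorics using (_C_; nCk+nC[k+1]≡[n+1]C[k+1])
open import Data.Nat.Divisibility using (1∣_; ∣-trans; ∣m⇒∣m*n; quotient)
open import Data.Nat.DivMod using (m/n*n≡m; m*n/n≡m)
open import Data.Nat.GCD using (gcd[m,n]∣m; gcd[m,n]∣n)
open import Data.Nat.ListAction using (product)
import Data.Nat.Properties as ℕₚ
open import Data.Nat.Tactic.RingSolver using (solve-∀)
open import Data.Product using (Σ; ∃; _,_; proj₁; proj₂; uncurry)
open import Data.Product.Function.Dependent.Propositional using () renaming (congˡ to Σ-congˡ)
open import Data.Product.Function.NonDependent.Propositional using (_×-↔_)
open import Data.Rational as ℚ using (ℚ; 1ℚ; _÷_; fromℚᵘ)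
import Data.Rational.Properties as ℚₚ
open import Data.Rational.Unnormalised as ℚᵘ using (mkℚᵘ; *≡*; *≤*)
import Data.Rational.Unnormalised.Properties as ℚᵘₚ
open import Data.Sum using (_⊎_; inj₁; inj₂; map₁; map₂; [_,_]′)
open import Data.Sum.Function.Propositional using (_⊎-↔_)
open import Data.Unit using (⊤; tt)
open import Data.Vec using ([]; _∷_; toList)
open import Data.Vec.Relation.Unary.All as All using ([]; _∷_; uncons)
open import Data.Vec.Relation.Unary.All.Properties using (lookup⁺)
open import Function using (_∘_; const; id; case_of_; Equivalence; Injection; Inverse; _⇔_; _↔_; mk⇔; mk↔ₛ′)
open import Function.Construct.Composition using (_↔-∘_)
open import Function.Construct.Identity using (↔-id)
open import Function.Construct.Symmetry using (↔-sym)
open import Function.Properties.Inverse using (↔⇒↣)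
open import Function.Related.Propositional using (bijection; ≡⇒)
open import Function.Related.TypeIsomorphisms using (×-comm)
open import Level using (0ℓ)
open import Relation.Binary using (Setoid)
open import Relation.Binary.PropositionalEquality
  using (_≢_; _≗_; refl; sym; trans; cong; cong₂; subst; subst₂; module ≡-Reasoning)
open import Relation.Nullary using (¬_; yes; no)
open import Relation.Unary using (Pred; _∈_; _≐_)
open import Relation.Unary.Properties using (≐-sym; ≐-trans)
open import Relation.Unary.Relation.Binary.Equality using (≐-setoid)
open Algebra.Properties.CommutativeMonoid.Sum ℕₚ.+-0-commutativeMonoid using (sum; sum-permute)

-- The two divisibility hypotheses meet in one constant, t = (k - 1) d / (v - 1). With ρ = e₁⋯eᵢ,
-- the increment yᵢ₊₁ - yᵢ is (k - 1) / (v - 1) times (eᵢ₊₁ - 1) ρ. If (eᵢ₊₁ - 1) ρ / d = c yᵢ, this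
-- increment is t c yᵢ, so yᵢ₊₁ / yᵢ is the natural number 1 + t c. The head of a point is its
-- finest coordinate, so the label type of a tree changes along the recursion. Statements on trees
-- therefore hold for all label types, and what the consumed coordinates contribute is a fact about
-- labels: how many there are and how many contain a given point. These numbers are compared as
-- shares, in cross-multiplied form. The share of labels through one point is yᵢ / ρ; the share
-- through two points is (yᵢ / ρ) (k - 1) / (v - 1) as soon as a coordinate has separated them, and
-- keeps this form at every later coordinate.

private variable
  A A′ : Set
  n m s x x₁ : ℕ

-- Labelled subsets of a finite set

-- m-subsets of Fin n whose elements are labelled in A
data Pick (A : Set) : ℕ → ℕ → Set where
  []   : Pick A 0 0
  skip : Pick A n m → Pick A (suc n) m
  take : A → Pick A n m → Pick A (suc n) (suc m)

pickAt : Pick A n m → Fin n → Maybe A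
pickAt (skip p)   zero    = nothing
pickAt (skip p)   (suc i) = pickAt p i
pickAt (take x p) zero    = just x
pickAt (take x p) (suc i) = pickAt p i

pickAt-injective : (p q : Pick A n m) → pickAt p ≗ pickAt q → p ≡ q
pickAt-injective []         []         eq = refl
pickAt-injective (skip p)   (skip q)   eq = cong skip (pickAt-injective p q (eq ∘ suc))
pickAt-injective (skip p)   (take x q) eq = case eq zero of λ ()
pickAt-injective (take x p) (skip q)   eq = case eq zero of λ ()
pickAt-injective (take x p) (take y q) eq =
  cong₂ take (just-injective (eq zero)) (pickAt-injective p q (eq ∘ suc))

mapPick : (Fin n → A → A′) → Pick A n m → Pick A′ n m
mapPick f []         = []
mapPick f (skip p)   = skip (mapPick (f ∘ suc) p)
mapPick f (take x p) = take (f zero x) (mapPick (f ∘ suc) p)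

pickAt-map : (f : Fin n → A → A′) (p : Pick A n m) → ∀ i → pickAt (mapPick f p) i ≡ Maybe.map (f i) (pickAt p i)
pickAt-map f (skip p)   zero    = refl
pickAt-map f (skip p)   (suc i) = pickAt-map (f ∘ suc) p i
pickAt-map f (take x p) zero    = refl
pickAt-map f (take x p) (suc i) = pickAt-map (f ∘ suc) p i

weight : Maybe A → ℕ
weight = maybe′ (const 1) 0

size : (Fin n → Maybe A) → ℕ
size h = sum (weight ∘ h)

size-pickAt : (p : Pick A n m) → size (pickAt p) ≡ m
size-pickAt []         = refl
size-pickAt (skip p)   = size-pickAt p
size-pickAt (take x p) = cong suc (size-pickAt p)

-- The number of elements is computed from `h`, so that every partial function qualifies;
-- `permutePick` corrects the index afterwards.
tabulatePick : ∀ {n} (h : Fin n → Maybe A) → ∃ λ (p : Pick A n (size h)) → pickAt p ≗ h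
tabulatePick {n = zero}  h = [] , λ ()
tabulatePick {n = suc n} h with h zero in eq | tabulatePick (h ∘ suc)
... | nothing | p , p≗ = skip p , λ { zero → sym eq ; (suc i) → p≗ i }
... | just x  | p , p≗ = take x p , λ { zero → sym eq ; (suc i) → p≗ i }

-- Precomposing with a permutation leaves the number of defined values unchanged, because a finite
-- sum is invariant under permutation of its terms.
permutePick : (π : Permutation′ n) (p : Pick A n m) →
              ∃ λ (q : Pick A n m) → ∀ i → pickAt q (π ⟨$⟩ʳ i) ≡ pickAt p i
permutePick {n} {A} π p = subst
  (λ m → ∃ λ (q : Pick A n m) → ∀ i → pickAt q (π ⟨$⟩ʳ i) ≡ pickAt p i)
  (trans (sym (sum-permute (weight ∘ pickAt p) (Perm.flip π))) (size-pickAt p))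
  (proj₁ q , λ i → trans (proj₂ q _) (cong (pickAt p) (Perm.inverseˡ π)))
  where q = tabulatePick (pickAt p ∘ (π ⟨$⟩ˡ_))

-- Permutations matching two supports

left? : {L R : Set} → L ⊎ R → Bool
left? = [ const true , const false ]′

-- Numbering the support and its complement separately allows two picks of equal size to be matched
-- through the common set `Fin m ⊎ Fin k`.
split : (p : Pick A n m) → ∃ λ k → m + k ≡ n ×
        Σ (Fin n ↔ (Fin m ⊎ Fin k)) λ f → ∀ i → is-just (pickAt p i) ≡ left? (Inverse.to f i)
split [] = 0 , refl , mk↔ₛ′ inj₁ [ (λ ()) , (λ ()) ]′ (λ { (inj₁ ()) ; (inj₂ ()) }) (λ ()) , λ ()
split {n = suc n} (skip {m = m} p) with split p
... | k , eq , f , occ = suc k , trans (ℕₚ.+-suc m k) (cong suc eq) , mk↔ₛ′ to from to-from from-to , occ′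
  where
  module f = Inverse f
  to : Fin (suc n) → Fin m ⊎ Fin (suc k)
  to zero    = inj₂ zero
  to (suc i) = map₂ suc (f.to i)
  from : Fin m ⊎ Fin (suc k) → Fin (suc n)
  from (inj₁ j)       = suc (f.from (inj₁ j))
  from (inj₂ zero)    = zero
  from (inj₂ (suc j)) = suc (f.from (inj₂ j))
  to-from : ∀ x → to (from x) ≡ x
  to-from (inj₁ j)       = cong (map₂ suc) (f.strictlyInverseˡ (inj₁ j))
  to-from (inj₂ zero)    = refl
  to-from (inj₂ (suc j)) = cong (map₂ suc) (f.strictlyInverseˡ (inj₂ j))
  from-map : ∀ x → from (map₂ suc x) ≡ suc (f.from x)
  from-map (inj₁ _) = refl
  from-map (inj₂ _) = refl
  from-to : ∀ i → from (to i) ≡ i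
  from-to zero    = refl
  from-to (suc i) = trans (from-map (f.to i)) (cong suc (f.strictlyInverseʳ i))
  left-map : (x : Fin m ⊎ Fin k) → left? x ≡ left? (map₂ Fin.suc x)
  left-map (inj₁ _) = refl
  left-map (inj₂ _) = refl
  occ′ : ∀ i → is-just (pickAt (skip p) i) ≡ left? (to i)
  occ′ zero    = refl
  occ′ (suc i) = trans (occ i) (left-map (f.to i))
split {n = suc n} (take {m = m} x p) with split p
... | k , eq , f , occ = k , cong suc eq , mk↔ₛ′ to from to-from from-to , occ′
  where
  module f = Inverse f
  to : Fin (suc n) → Fin (suc m) ⊎ Fin k
  to zero    = inj₁ zero
  to (suc i) = map₁ suc (f.to i)
  from : Fin (suc m) ⊎ Fin k → Fin (suc n)
  from (inj₁ zero)    = zero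
  from (inj₁ (suc j)) = suc (f.from (inj₁ j))
  from (inj₂ j)       = suc (f.from (inj₂ j))
  to-from : ∀ x → to (from x) ≡ x
  to-from (inj₁ zero)    = refl
  to-from (inj₁ (suc j)) = cong (map₁ suc) (f.strictlyInverseˡ (inj₁ j))
  to-from (inj₂ j)       = cong (map₁ suc) (f.strictlyInverseˡ (inj₂ j))
  from-map : ∀ x → from (map₁ suc x) ≡ suc (f.from x)
  from-map (inj₁ _) = refl
  from-map (inj₂ _) = refl
  from-to : ∀ i → from (to i) ≡ i
  from-to zero    = refl
  from-to (suc i) = trans (from-map (f.to i)) (cong suc (f.strictlyInverseʳ i))
  left-map : (x : Fin m ⊎ Fin k) → left? x ≡ left? (map₁ Fin.suc x)
  left-map (inj₁ _) = refl
  left-map (inj₂ _) = refl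
  occ′ : ∀ i → is-just (pickAt (take x p) i) ≡ left? (to i)
  occ′ zero    = refl
  occ′ (suc i) = trans (occ i) (left-map (f.to i))

transpose-invariant : (P : Fin n → Bool) → ∀ i j → P i ≡ P j → ∀ k → P (transpose i j ⟨$⟩ʳ k) ≡ P k
transpose-invariant P i j eq k with k ≟ i
... | yes refl = sym eq
... | no _ with k ≟ j
...   | yes refl = eq
...   | no _     = refl

transpose-maps : (i j : Fin n) → transpose i j ⟨$⟩ʳ i ≡ j
transpose-maps i j with i ≟ i
... | yes _  = refl
... | no i≢i = ⊥-elim (i≢i refl)

alignSupports : (p q : Pick A n m) → ∃ λ (π : Permutation′ n) →
                ∀ i → is-just (pickAt p i) ≡ is-just (pickAt q (π ⟨$⟩ʳ i))
alignSupports {m = m} p q with split p | split q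
-- Cancelling `m` shows the two complements to be equally large, so both bijections end in the same
-- sum.
... | k , eq , f , occ | k′ , eq′ , f′ , occ′ with ℕₚ.+-cancelˡ-≡ m k k′ (trans eq (sym eq′))
... | refl = ↔-sym f′ ↔-∘ f , λ i →
  trans (occ i) (sym (trans (occ′ _) (cong left? (Inverse.strictlyInverseˡ f′ (Inverse.to f i)))))

-- A transposition inside the support of `q` moves the image of `a` to `b`. The last claim is
-- conditional because `alignTrees` uses the same `a` and `b` over all tails, and they are known to
-- be occupied over one tail only.
alignPicks : (p q : Pick A n m) (a b : Fin n) → ∃ λ (π : Permutation′ n) →
             (∀ i → is-just (pickAt p i) ≡ is-just (pickAt q (π ⟨$⟩ʳ i))) ×
             (is-just (pickAt p a) ≡ true → is-just (pickAt q b) ≡ true → π ⟨$⟩ʳ a ≡ b)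
alignPicks p q a b with alignSupports p q
... | π , occ with is-just (pickAt p a) in pa | is-just (pickAt q b) in qb
... | true  | true  = transpose (π ⟨$⟩ʳ a) b ↔-∘ π
                    , (λ i → trans (occ i) (sym (transpose-invariant (is-just ∘ pickAt q) (π ⟨$⟩ʳ a) b
                                                   (trans (trans (sym (occ a)) pa) (sym qb)) (π ⟨$⟩ʳ i))))
                    , λ _ _ → transpose-maps (π ⟨$⟩ʳ a) b
... | false | _     = π , occ , λ ()
... | true  | false = π , occ , λ _ ()

-- Trees encoding blocks

-- Tree e m ⊤ encodes the blocks of the orbit: over each point of the block of es lies an m₁-subset of the fibre.
Tree : ∀ {s} → Vec ℕ s → (Fin s → ℕ) → Set → Set
Tree []       m A = A
Tree (e ∷ es) m A = Tree es (m ∘ suc) (Pick A e (m zero))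

_!_ : Maybe (Pick A n m) → Fin n → Maybe A
x ! a = x >>= λ p → pickAt p a

treeAt : (es : Vec ℕ s) {m : Fin s → ℕ} → Tree es m A → Chain.Point es → Maybe A
treeAt []       x []      = just x
treeAt (e ∷ es) t (a ∷ r) = treeAt es t r ! a

-- The function sees the point because an element of the wreath product permutes the first
-- coordinate differently over each tail.
mapTree : (es : Vec ℕ s) {m : Fin s → ℕ} → (Chain.Point es → A → A′) → Tree es m A → Tree es m A′
mapTree []       f t = f [] t
mapTree (e ∷ es) f t = mapTree es (λ r → mapPick (λ a → f (a ∷ r))) t

treeAt-map : (es : Vec ℕ s) {m : Fin s → ℕ} (f : Chain.Point es → A → A′) (t : Tree es m A) →
             ∀ p → treeAt es (mapTree es f t) p ≡ Maybe.map (f p) (treeAt es t p)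
treeAt-map []       f t []      = refl
treeAt-map (e ∷ es) f t (a ∷ r) =
  trans (cong (_! a) (treeAt-map es (λ r → mapPick (λ a → f (a ∷ r))) t r)) (go (treeAt es t r))
  where
  go : (x : Maybe (Pick _ _ _)) →
       Maybe.map (mapPick (λ a → f (a ∷ r))) x ! a ≡ Maybe.map (f (a ∷ r)) (x ! a)
  go nothing  = refl
  go (just p) = pickAt-map (λ a → f (a ∷ r)) p a

pick-nonempty : 1 ≤ m → (p : Pick A n m) → ∃[ i ] ∃[ x ] pickAt p i ≡ just x
pick-nonempty 1≤m (skip p)   = let i , x , eq = pick-nonempty 1≤m p in suc i , x , eq
pick-nonempty _   (take x p) = zero , x , refl

-- An empty pick and an absent one have the same values; `1 ≤ m` rules out the former.
!-injective : 1 ≤ m → (x y : Maybe (Pick A n m)) → (∀ a → x ! a ≡ y ! a) → x ≡ y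
!-injective 1≤m nothing  nothing  eq = refl
!-injective 1≤m nothing  (just q) eq =
  let a , _ , q[a] = pick-nonempty 1≤m q in case trans (eq a) q[a] of λ ()
!-injective 1≤m (just p) nothing  eq =
  let a , _ , p[a] = pick-nonempty 1≤m p in case trans (sym (eq a)) p[a] of λ ()
!-injective 1≤m (just p) (just q) eq = cong just (pickAt-injective p q eq)

treeAt-injective : (es : Vec ℕ s) {m : Fin s → ℕ} → (∀ j → 1 ≤ m j) → (t u : Tree es m A) →
                   treeAt es t ≗ treeAt es u → t ≡ u
treeAt-injective []       1≤m t u eq = just-injective (eq [])
treeAt-injective (e ∷ es) 1≤m t u eq = treeAt-injective es (1≤m ∘ suc) t u
  λ r → !-injective (1≤m zero) (treeAt es t r) (treeAt es u r) (λ a → eq (a ∷ r))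

-- The wreath product, one coordinate at a time

lookup⁺-injective : {es : Vec ℕ s} (p q : Chain.Point es) → (∀ j → lookup⁺ p j ≡ lookup⁺ q j) → p ≡ q
lookup⁺-injective []      []      eq = refl
lookup⁺-injective (a ∷ p) (b ∷ q) eq = cong₂ _∷_ (eq zero) (lookup⁺-injective p q (eq ∘ suc))

·-injective : {P : Set} (g : Sym P) {p q : P} → g · p ≡ g · q → p ≡ q
·-injective g = Injection.injective (↔⇒↣ g)

module _ {e : ℕ} {es : Vec ℕ s} where

  𝒞-zero⇒≡ : (p q : Chain.Point (e ∷ es)) → Chain.𝒞 (e ∷ es) zero p q → p ≡ q
  𝒞-zero⇒≡ p q eq = lookup⁺-injective p q (λ j → eq j z≤n)

  𝒞-tail : ∀ i (p q : Chain.Point (e ∷ es)) → Chain.𝒞 (e ∷ es) (suc i) p q → Chain.𝒞 es i (All.tail p) (All.tail q)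
  𝒞-tail i (_ ∷ _) (_ ∷ _) eq j i≤j = eq (suc j) (s≤s i≤j)

  𝒞-cons : ∀ i (p q : Chain.Point (e ∷ es)) → Chain.𝒞 es i (All.tail p) (All.tail q) → Chain.𝒞 (e ∷ es) (suc i) p q
  𝒞-cons i (_ ∷ _) (_ ∷ _) eq zero    ()
  𝒞-cons i (_ ∷ _) (_ ∷ _) eq (suc j) (s≤s i≤j) = eq j i≤j

  𝒞₁⇒tail≡ : (p q : Chain.Point (e ∷ es)) → Chain.𝒞 (e ∷ es) (suc zero) p q → All.tail p ≡ All.tail q
  𝒞₁⇒tail≡ p q eq = lookup⁺-injective _ _ λ j → 𝒞-tail zero p q eq j z≤n

  tail≡⇒𝒞₁ : (p q : Chain.Point (e ∷ es)) → All.tail p ≡ All.tail q → Chain.𝒞 (e ∷ es) (suc zero) p q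
  tail≡⇒𝒞₁ p q eq = 𝒞-cons zero p q (λ j _ → cong (λ x → lookup⁺ x j) eq)

  consPerm : (Chain.Point es → Permutation′ e) → Sym (Chain.Point es) → Sym (Chain.Point (e ∷ es))
  consPerm σ g = mk↔ₛ′ to from to-from from-to
    where
    g⁻¹ = Inverse.from g
    to from : Chain.Point (e ∷ es) → Chain.Point (e ∷ es)
    to   (a ∷ r) = (σ r ⟨$⟩ʳ a) ∷ (g · r)
    from (a ∷ r) = (σ (g⁻¹ r) ⟨$⟩ˡ a) ∷ g⁻¹ r
    to-from : ∀ p → to (from p) ≡ p
    to-from (a ∷ r) = cong₂ _∷_ (Perm.inverseʳ (σ (g⁻¹ r))) (Inverse.strictlyInverseˡ g r)
    from-to : ∀ p → from (to p) ≡ p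
    from-to (a ∷ r) rewrite Inverse.strictlyInverseʳ g r = cong (_∷ r) (Perm.inverseˡ (σ r))

  consPerm-∈ : ∀ σ {g} → g ∈ Chain.Wreath es → consPerm σ g ∈ Chain.Wreath (e ∷ es)
  consPerm-∈ σ {g} g∈ zero p q = mk⇔
    (λ eq j _ → cong (λ x → lookup⁺ (consPerm σ g · x) j) (𝒞-zero⇒≡ p q eq))
    (λ eq j _ → cong (λ x → lookup⁺ x j)
                  (·-injective (consPerm σ g) (𝒞-zero⇒≡ (consPerm σ g · p) (consPerm σ g · q) eq)))
  consPerm-∈ σ {g} g∈ (suc i) p@(_ ∷ r) q@(_ ∷ r′) = mk⇔
    (λ eq → 𝒞-cons i (consPerm σ g · p) (consPerm σ g · q) (Equivalence.to (g∈ i r r′) (𝒞-tail i p q eq)))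
    (λ eq → 𝒞-cons i p q
              (Equivalence.from (g∈ i r r′) (𝒞-tail i (consPerm σ g · p) (consPerm σ g · q) eq)))

  -- The converse of `consPerm`. Invariance of the second partition of the chain makes `g` act on
  -- tails, and invariance of the later ones puts this action into the smaller wreath product. The
  -- action is read off at a representative `a₀` of each class.
  module Uncons (0<e : 0 < e) {g : Sym (Chain.Point (e ∷ es))} (g∈ : g ∈ Chain.Wreath (e ∷ es)) where

    private
      module g = Inverse g
      a₀ : Fin e
      a₀ = fromℕ< 0<e

    tail-cong : ∀ p q → All.tail p ≡ All.tail q → All.tail (g · p) ≡ All.tail (g · q)
    tail-cong p q eq = 𝒞₁⇒tail≡ (g · p) (g · q) (Equivalence.to (g∈ (suc zero) p q) (tail≡⇒𝒞₁ p q eq))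

    tail-injective : ∀ p q → All.tail (g · p) ≡ All.tail (g · q) → All.tail p ≡ All.tail q
    tail-injective p q eq =
      𝒞₁⇒tail≡ p q (Equivalence.from (g∈ (suc zero) p q) (tail≡⇒𝒞₁ (g · p) (g · q) eq))

    tailPerm : Sym (Chain.Point es)
    tailPerm = mk↔ₛ′ (λ r → All.tail (g.to (a₀ ∷ r))) (λ r → All.tail (g.from (a₀ ∷ r)))
      -- The head of the preimage need not be `a₀`; `tail-cong` allows the exchange.
      (λ r → trans (tail-cong (a₀ ∷ All.tail (g.from (a₀ ∷ r))) (g.from (a₀ ∷ r)) refl)
                   (cong All.tail (g.strictlyInverseˡ (a₀ ∷ r))))
      (λ r → tail-injective _ (a₀ ∷ r) (cong All.tail (g.strictlyInverseˡ _)))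

    tailPerm-∈ : tailPerm ∈ Chain.Wreath es
    tailPerm-∈ i r r′ = mk⇔
      (λ eq → 𝒞-tail i (g · p) (g · q) (Equivalence.to (g∈ (suc i) p q) (𝒞-cons i p q eq)))
      (λ eq → 𝒞-tail i p q (Equivalence.from (g∈ (suc i) p q) (𝒞-cons i (g · p) (g · q) eq)))
      where
      p = a₀ ∷ r
      q = a₀ ∷ r′

    head-tail : ∀ {p : Chain.Point (e ∷ es)} {r} → All.tail p ≡ r → p ≡ All.head p ∷ r
    head-tail {_ ∷ _} refl = refl

    g-cons : ∀ a r → g · (a ∷ r) ≡ All.head (g · (a ∷ r)) ∷ (tailPerm · r)
    g-cons a r = head-tail (tail-cong (a ∷ r) (a₀ ∷ r) refl)

    g⁻¹-cons : ∀ b r → g.from (b ∷ (tailPerm · r)) ≡ All.head (g.from (b ∷ (tailPerm · r))) ∷ r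
    g⁻¹-cons b r = head-tail (tail-injective _ (a₀ ∷ r) (cong All.tail (g.strictlyInverseˡ _)))

    headPerm : Chain.Point es → Permutation′ e
    headPerm r = mk↔ₛ′ (λ a → All.head (g.to (a ∷ r))) (λ b → All.head (g.from (b ∷ (tailPerm · r))))
      (λ b → cong All.head (trans (cong g.to (sym (g⁻¹-cons b r))) (g.strictlyInverseˡ _)))
      (λ a → cong All.head (trans (cong g.from (sym (g-cons a r))) (g.strictlyInverseʳ _)))

-- Action of the wreath product on trees

!-map : (f : Pick A n m → Pick A′ n m) (x : Maybe (Pick A n m)) (R : Maybe A → Maybe A′ → Set) (a b : Fin n) →
        R nothing nothing → (∀ p → R (pickAt p a) (pickAt (f p) b)) → R (x ! a) (Maybe.map f x ! b)
!-map f nothing  R a b c₀ c = c₀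
!-map f (just p) R a b c₀ c = c p

-- Each pick is permuted while its tail is still in place, since `headPerm` is indexed by the old
-- tail. The induction hypothesis then moves the tails and carries the picks along as labels.
permuteTree : (es : Vec ℕ s) {m : Fin s → ℕ} → All (0 <_) es → ∀ {g} → g ∈ Chain.Wreath es → (t : Tree es m A) →
              ∃ λ (u : Tree es m A) → ∀ p → treeAt es u (g · p) ≡ treeAt es t p
permuteTree []       []           {g} g∈ t = t , λ { [] → go (g · []) }
  where
  go : (p : Chain.Point []) → treeAt [] t p ≡ just t
  go [] = refl
permuteTree (e ∷ es) {m} (0<e ∷ 0<es) {g} g∈ t = u , λ { (a ∷ r) → begin
  treeAt (e ∷ es) u (g · (a ∷ r))                        ≡⟨ cong (treeAt (e ∷ es) u) (g-cons a r) ⟩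
  treeAt es u (tailPerm · r) ! (headPerm r ⟨$⟩ʳ a)       ≡⟨ cong (_! (headPerm r ⟨$⟩ʳ a)) (u-at r) ⟩
  treeAt es (mapTree es move t) r ! (headPerm r ⟨$⟩ʳ a)  ≡⟨ cong (_! (headPerm r ⟨$⟩ʳ a)) (treeAt-map es move t r) ⟩
  Maybe.map (move r) (treeAt es t r) ! (headPerm r ⟨$⟩ʳ a)
    ≡⟨ !-map (move r) (treeAt es t r) (λ x y → y ≡ x) a (headPerm r ⟨$⟩ʳ a) refl
         (λ p → proj₂ (permutePick (headPerm r) p) a) ⟩
  treeAt es t r ! a                                      ∎ }
  where
  open Uncons 0<e {g} g∈
  open ≡-Reasoning
  move : Chain.Point es → Pick _ e (m zero) → Pick _ e (m zero)
  move r p = proj₁ (permutePick (headPerm r) p)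
  IH = permuteTree es 0<es {tailPerm} tailPerm-∈ (mapTree es move t)
  u = proj₁ IH
  u-at = proj₂ IH

alignMaybePicks : (x y : Maybe (Pick A n m)) (a b : Fin n) → is-just x ≡ is-just y →
                  ∃ λ (π : Permutation′ n) →
                  (∀ i → is-just (x ! i) ≡ is-just (y ! (π ⟨$⟩ʳ i))) ×
                  (is-just (x ! a) ≡ true → is-just (y ! b) ≡ true → π ⟨$⟩ʳ a ≡ b)
alignMaybePicks nothing  nothing  a b _ = Perm.id , (λ _ → refl) , λ ()
alignMaybePicks (just p) (just q) a b _ = alignPicks p q a b

is-just-! : (x : Maybe (Pick A n m)) (a : Fin n) → is-just (x ! a) ≡ true → is-just x ≡ true
is-just-! (just _) _ _ = refl

-- The induction hypothesis matches the tails and ignores the picks over them. Over a tail in the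
-- support the two picks have equal size and can be matched afterwards; elsewhere the identity will
-- do.
alignTrees : (es : Vec ℕ s) {m : Fin s → ℕ} (t u : Tree es m A) (p q : Chain.Point es) →
             is-just (treeAt es t p) ≡ true → is-just (treeAt es u q) ≡ true →
             ∃ λ (g : Sym (Chain.Point es)) → g ∈ Chain.Wreath es × g · p ≡ q ×
             (∀ x → is-just (treeAt es t x) ≡ is-just (treeAt es u (g · x)))
alignTrees []       t u []      []      _  _  = ↔-id _ , (λ _ _ _ → mk⇔ id id) , refl , λ { [] → refl }
alignTrees (e ∷ es) t u (a ∷ r) (b ∷ r′) tp uq =
  consPerm σ g , consPerm-∈ σ g∈ , cong₂ _∷_ σra≡b gr≡r′ ,
  λ { (a ∷ r) → proj₁ (proj₂ (align r)) a }
  where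
  IH = alignTrees es t u r r′ (is-just-! (treeAt es t r) a tp) (is-just-! (treeAt es u r′) b uq)
  g = proj₁ IH
  g∈ = proj₁ (proj₂ IH)
  gr≡r′ = proj₁ (proj₂ (proj₂ IH))
  align = λ x → alignMaybePicks (treeAt es t x) (treeAt es u (g · x)) a b (proj₂ (proj₂ (proj₂ IH)) x)
  σ = λ x → proj₁ (align x)
  σra≡b : σ r ⟨$⟩ʳ a ≡ b
  σra≡b = proj₂ (proj₂ (align r)) tp (trans (cong (λ x → is-just (treeAt es u x ! b)) gr≡r′) uq)

-- Counting labelled subsets

-- Used to express the number of picks through one or two fixed positions as a share of all picks.
absorption : ∀ n k → (suc n C suc k) * suc k ≡ suc n * (n C k)
absorption zero    zero    = refl
absorption zero    (suc k) = refl
absorption (suc n) zero    = begin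
  (suc (suc n) C 1) * 1        ≡⟨ cong (_* 1) (nCk+nC[k+1]≡[n+1]C[k+1] (suc n) 0) ⟨
  (1 + (suc n C 1)) * 1        ≡⟨ ℕₚ.*-distribʳ-+ 1 1 (suc n C 1) ⟩
  1 + (suc n C 1) * 1          ≡⟨ cong (λ z → 1 + z) (absorption n 0) ⟩
  suc (suc n) * 1              ∎
  where open ≡-Reasoning
absorption (suc n) (suc k) = begin
  (suc (suc n) C suc (suc k)) * suc (suc k)
    ≡⟨ cong (_* suc (suc k)) (nCk+nC[k+1]≡[n+1]C[k+1] (suc n) (suc k)) ⟨
  ((suc n C suc k) + (suc n C suc (suc k))) * suc (suc k)
    ≡⟨ regroup (suc n C suc k) (suc n C suc (suc k)) (suc k) ⟩
  (suc n C suc k) + ((suc n C suc k) * suc k + (suc n C suc (suc k)) * suc (suc k))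
    ≡⟨ cong (λ z → (suc n C suc k) + z) (cong₂ _+_ (absorption n k) (absorption n (suc k))) ⟩
  (suc n C suc k) + (suc n * (n C k) + suc n * (n C suc k))
    ≡⟨ cong (λ z → (suc n C suc k) + z) (ℕₚ.*-distribˡ-+ (suc n) (n C k) (n C suc k)) ⟨
  (suc n C suc k) + suc n * ((n C k) + (n C suc k))
    ≡⟨ cong (λ c → (suc n C suc k) + suc n * c) (nCk+nC[k+1]≡[n+1]C[k+1] n k) ⟩
  suc (suc n) * (suc n C suc k) ∎
  where
  open ≡-Reasoning
  regroup : ∀ u v k → (u + v) * suc k ≡ u + (u * k + v * suc k)
  regroup = solve-∀

Fin-cast : n ≡ m → A ↔ Fin n → A ↔ Fin m
Fin-cast {A = A} eq = subst (λ k → A ↔ Fin k) eq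

_×ᶠ_ : A ↔ Fin n → A′ ↔ Fin m → (A × A′) ↔ Fin (n * m)
f ×ᶠ g = ↔-sym Finₚ.*↔× ↔-∘ (f ×-↔ g)

_⊎ᶠ_ : A ↔ Fin n → A′ ↔ Fin m → (A ⊎ A′) ↔ Fin (n + m)
f ⊎ᶠ g = ↔-sym Finₚ.+↔⊎ ↔-∘ (f ⊎-↔ g)

empty : ¬ A → A ↔ Fin 0
empty ¬a = mk↔ₛ′ (⊥-elim ∘ ¬a) (λ ()) (λ ()) (⊥-elim ∘ ¬a)

Holds : (A → Set) → Maybe A → Set
Holds P = maybe′ P ⊥

module _ (A↔ : A ↔ Fin x) where

  Pick-↔ : ∀ n m → Pick A n m ↔ Fin ((n C m) * x ^ m)
  Pick-↔ zero    zero    = mk↔ₛ′ (λ _ → zero) (λ _ → []) (λ { zero → refl }) (λ { [] → refl })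
  Pick-↔ zero    (suc m) = empty λ ()
  Pick-↔ (suc n) zero    = Pick-↔ n zero ↔-∘
    mk↔ₛ′ (λ { (skip p) → p }) skip (λ _ → refl) (λ { (skip _) → refl })
  Pick-↔ (suc n) (suc m) = Fin-cast count (((A↔ ×ᶠ Pick-↔ n m) ⊎ᶠ Pick-↔ n (suc m)) ↔-∘
    mk↔ₛ′ (λ { (take a p) → inj₁ (a , p) ; (skip p) → inj₂ p })
          (λ { (inj₁ (a , p)) → take a p ; (inj₂ p) → skip p })
          (λ { (inj₁ _) → refl ; (inj₂ _) → refl })
          (λ { (take _ _) → refl ; (skip _) → refl }))
    where
    regroup : ∀ c c′ x z → x * (c * z) + c′ * (x * z) ≡ (c + c′) * (x * z)
    regroup = solve-∀
    count : x * ((n C m) * x ^ m) + (n C suc m) * x ^ suc m ≡ (suc n C suc m) * x ^ suc m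
    count = trans (regroup (n C m) (n C suc m) x (x ^ m))
                  (cong (_* x ^ suc m) (nCk+nC[k+1]≡[n+1]C[k+1] n m))

  Σ-Pick-zero : (P : Pick A (suc n) (suc m) → Set) → Σ (Pick A (suc n) (suc m)) P ↔
                (Σ A (λ a → Σ (Pick A n m) (λ p → P (take a p))) ⊎ Σ (Pick A n (suc m)) (P ∘ skip))
  Σ-Pick-zero P =
    mk↔ₛ′ (λ { (take a p , h) → inj₁ (a , p , h) ; (skip p , h) → inj₂ (p , h) })
          (λ { (inj₁ (a , p , h)) → take a p , h ; (inj₂ (p , h)) → skip p , h })
          (λ { (inj₁ _) → refl ; (inj₂ _) → refl })
          (λ { (take _ _ , _) → refl ; (skip _ , _) → refl })

  Σ-Pick-occupied-zero : (P : A → Set) → Σ (Pick A (suc n) (suc m)) (λ p → Holds P (pickAt p zero)) ↔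
                         (Σ A P × Pick A n m)
  Σ-Pick-occupied-zero P =
    mk↔ₛ′ (λ { (take a p , h) → (a , h) , p ; (skip p , ()) })
          (λ { ((a , h) , p) → take a p , h }) (λ _ → refl)
          (λ { (take _ _ , _) → refl ; (skip _ , ()) })

  Σ-Pick-occupied-zero-suc : (P Q : A → Set) (j : Fin n) →
    Σ (Pick A (suc n) (suc m)) (λ p → Holds P (pickAt p zero) × Holds Q (pickAt p (suc j))) ↔
    (Σ A P × Σ (Pick A n m) (λ p → Holds Q (pickAt p j)))
  Σ-Pick-occupied-zero-suc P Q j =
    mk↔ₛ′ (λ { (take a p , h , h′) → (a , h) , (p , h′) ; (skip p , () , _) })
          (λ { ((a , h) , (p , h′)) → take a p , h , h′ }) (λ _ → refl)
          (λ { (take _ _ , _) → refl ; (skip _ , () , _) })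

  unoccupied : (P : A → Set) (p : Pick A n 0) (i : Fin n) → ¬ Holds P (pickAt p i)
  unoccupied P (skip p) zero    ()
  unoccupied P (skip p) (suc i) = unoccupied P p i

  -- The label at `i` is one of `x₁`; the other `m` elements lie anywhere among the remaining `n`
  -- positions and have free labels. The predicate `P` will say that a label contains the earlier
  -- coordinates of a point.
  Pick∋-↔ : {P : A → Set} → Σ A P ↔ Fin x₁ → ∀ n m (i : Fin (suc n)) →
            Σ (Pick A (suc n) (suc m)) (λ p → Holds P (pickAt p i)) ↔ Fin ((n C m) * x₁ * x ^ m)
  Pick∋-↔ {x₁} P↔ n m zero = Fin-cast (regroup (n C m) x₁ (x ^ m)) ((P↔ ×ᶠ Pick-↔ n m) ↔-∘ Σ-Pick-occupied-zero _)
    where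
    regroup : ∀ c x₁ z → x₁ * (c * z) ≡ c * x₁ * z
    regroup = solve-∀
  -- A pick with a single element, taken at position zero, misses `suc i`; this accounts for the
  -- summand `x * 0`.
  Pick∋-↔ {x₁} {P} P↔ (suc n) zero (suc i) = Fin-cast (cong (_+ (n C 0) * x₁ * 1) (ℕₚ.*-zeroʳ x))
    (((A↔ ×ᶠ empty λ (p , h) → unoccupied P p i h) ⊎ᶠ Pick∋-↔ P↔ n zero i) ↔-∘ Σ-Pick-zero _)
  Pick∋-↔ {x₁} P↔ (suc n) (suc m) (suc i) = Fin-cast count
    (((A↔ ×ᶠ Pick∋-↔ P↔ n m i) ⊎ᶠ Pick∋-↔ P↔ n (suc m) i) ↔-∘ Σ-Pick-zero _)
    where
    regroup : ∀ c c′ x x₁ z → x * (c * x₁ * z) + c′ * x₁ * (x * z) ≡ (c + c′) * x₁ * (x * z)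
    regroup = solve-∀
    count : x * ((n C m) * x₁ * x ^ m) + (n C suc m) * x₁ * x ^ suc m ≡ (suc n C suc m) * x₁ * x ^ suc m
    count = trans (regroup (n C m) (n C suc m) x x₁ (x ^ m))
                  (cong (λ c → c * x₁ * x ^ suc m) (nCk+nC[k+1]≡[n+1]C[k+1] n m))

  not-both-occupied : (P Q : A → Set) (p : Pick A n 1) (i j : Fin n) → i ≢ j →
                      ¬ (Holds P (pickAt p i) × Holds Q (pickAt p j))
  not-both-occupied P Q p          zero    zero    i≢j _        = i≢j refl
  not-both-occupied P Q (take _ p) zero    (suc j) i≢j (_ , h)  = unoccupied Q p j h
  not-both-occupied P Q (take _ p) (suc i) zero    i≢j (h , _)  = unoccupied P p i h
  not-both-occupied P Q (take _ p) (suc i) (suc j) i≢j (_ , h)  = unoccupied Q p j h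
  not-both-occupied P Q (skip p)   (suc i) (suc j) i≢j h        =
    not-both-occupied P Q p i j (i≢j ∘ cong suc) h

  -- Labels at distinct positions are independent, whence the factor `x₁ * x₁`. As `P` and `Q` have
  -- equally many labels, the case with `j` in front reduces to the one with `i` in front.
  Pick∋∋-↔ : {P Q : A → Set} → Σ A P ↔ Fin x₁ → Σ A Q ↔ Fin x₁ →
             ∀ n m (i j : Fin (suc (suc n))) → i ≢ j →
             Σ (Pick A (suc (suc n)) (suc (suc m))) (λ p → Holds P (pickAt p i) × Holds Q (pickAt p j)) ↔
             Fin ((n C m) * (x₁ * x₁) * x ^ m)
  Pick∋∋-↔ P↔ Q↔ n m zero zero i≢j = ⊥-elim (i≢j refl)
  Pick∋∋-↔ {x₁} P↔ Q↔ n m zero (suc j) _ = Fin-cast (regroup (n C m) x₁ (x ^ m))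
    ((P↔ ×ᶠ Pick∋-↔ Q↔ n m j) ↔-∘ Σ-Pick-occupied-zero-suc _ _ j)
    where
    regroup : ∀ c x₁ z → x₁ * (c * x₁ * z) ≡ c * (x₁ * x₁) * z
    regroup = solve-∀
  Pick∋∋-↔ {x₁} P↔ Q↔ n m (suc i) zero _ = Fin-cast (regroup (n C m) x₁ (x ^ m))
    ((Q↔ ×ᶠ Pick∋-↔ P↔ n m i) ↔-∘ (Σ-Pick-occupied-zero-suc _ _ i ↔-∘ Σ-congˡ {k = bijection} (×-comm _ _)))
    where
    regroup : ∀ c x₁ z → x₁ * (c * x₁ * z) ≡ c * (x₁ * x₁) * z
    regroup = solve-∀
  Pick∋∋-↔ P↔ Q↔ zero m (suc zero) (suc zero) i≢j = ⊥-elim (i≢j refl)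
  Pick∋∋-↔ {x₁} {P} {Q} P↔ Q↔ (suc n) zero (suc i) (suc j) i≢j = Fin-cast (cong (_+ (n C 0) * (x₁ * x₁) * 1) (ℕₚ.*-zeroʳ x))
    (((A↔ ×ᶠ empty λ (p , h) → not-both-occupied P Q p i j (i≢j ∘ cong suc) h) ⊎ᶠ
      Pick∋∋-↔ P↔ Q↔ n zero i j (i≢j ∘ cong suc)) ↔-∘ Σ-Pick-zero _)
  Pick∋∋-↔ {x₁} P↔ Q↔ (suc n) (suc m) (suc i) (suc j) i≢j = Fin-cast count
    (((A↔ ×ᶠ Pick∋∋-↔ P↔ Q↔ n m i j (i≢j ∘ cong suc)) ⊎ᶠ
      Pick∋∋-↔ P↔ Q↔ n (suc m) i j (i≢j ∘ cong suc)) ↔-∘ Σ-Pick-zero _)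
    where
    regroup : ∀ c c′ x x₁ z → x * (c * x₁ * z) + c′ * x₁ * (x * z) ≡ (c + c′) * x₁ * (x * z)
    regroup = solve-∀
    count : x * ((n C m) * (x₁ * x₁) * x ^ m) + (n C suc m) * (x₁ * x₁) * x ^ suc m
            ≡ (suc n C suc m) * (x₁ * x₁) * x ^ suc m
    count = trans (regroup (n C m) (n C suc m) x (x₁ * x₁) (x ^ m))
                  (cong (λ c → c * (x₁ * x₁) * x ^ suc m) (nCk+nC[k+1]≡[n+1]C[k+1] n m))

-- The number of trees over `x` labels, obtained by iterating the count in `Pick-↔`.
treeCount : Vec ℕ s → (Fin s → ℕ) → ℕ → ℕ
treeCount []       m x = x
treeCount (e ∷ es) m x = treeCount es (m ∘ suc) ((e C m zero) * x ^ m zero)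

Holds-! : (P : A → Set) (q : Maybe (Pick A n m)) (i : Fin n) →
          Holds P (q ! i) ≡ Holds (λ p → Holds P (pickAt p i)) q
Holds-! P nothing  i = refl
Holds-! P (just p) i = refl

Holds-∩ : (P Q : A → Set) (a : Maybe A) → (Holds P a × Holds Q a) ↔ Holds (λ x → P x × Q x) a
Holds-∩ P Q nothing  = mk↔ₛ′ proj₁ (λ ()) (λ ()) (λ ())
Holds-∩ P Q (just a) = ↔-id _

-- Shares of trees through one and two points

-- ρ and η stand for e₁⋯eⱼ₋₁ and m₁⋯mⱼ₋₁, and slope says η′ - η = (κ / w) (ρ′ - ρ).
record LevelStep (w κ e m ρ η ρ′ η′ : ℕ) : Set where
  field
    2≤e   : 2 ≤ e
    2≤m   : 2 ≤ m
    0<ρ   : 0 < ρ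
    ρ′≡   : ρ′ ≡ ρ * e
    η′≡   : η′ ≡ η * m
    slope : (m ∸ 1) * η * w ≡ (e ∸ 1) * ρ * κ

module _ {w κ : ℕ} where

  -- By `absorption`, a fixed position is occupied in the fraction m / e of all picks, and η / ρ
  -- grows to η′ / ρ′ by the same factor. The multipliers `u` and `v` are 1 for a single point, and
  -- `w` and `κ` for two points that the same label has to contain.
  incidence-step : ∀ {e m ρ η ρ′ η′ z} → LevelStep w κ (suc (suc e)) (suc (suc m)) ρ η ρ′ η′ →
                   ∀ u v → z * ρ * u ≡ x * η * v →
                   ((suc e C suc m) * z * x ^ suc m) * ρ′ * u ≡
                   ((suc (suc e) C suc (suc m)) * x ^ suc (suc m)) * η′ * v
  incidence-step {x} {e} {m} {ρ} {η} {z = z} L u v eq rewrite LevelStep.ρ′≡ L | LevelStep.η′≡ L = begin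
    ((suc e C suc m) * z * x ^ suc m) * (ρ * suc (suc e)) * u
      ≡⟨ lhs (suc e C suc m) z (x ^ suc m) ρ (suc (suc e)) u ⟩
    (suc (suc e) * (suc e C suc m)) * x ^ suc m * (z * ρ * u)
      ≡⟨ cong₂ (λ c d → c * x ^ suc m * d) (sym (absorption (suc e) (suc m))) eq ⟩
    ((suc (suc e) C suc (suc m)) * suc (suc m)) * x ^ suc m * (x * η * v)
      ≡⟨ rhs (suc (suc e) C suc (suc m)) (suc (suc m)) (x ^ suc m) x η v ⟩
    ((suc (suc e) C suc (suc m)) * x ^ suc (suc m)) * (η * suc (suc m)) * v ∎
    where
    open ≡-Reasoning
    lhs : ∀ c z t ρ e u → (c * z * t) * (ρ * e) * u ≡ (e * c) * t * (z * ρ * u)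
    lhs = solve-∀
    rhs : ∀ c m t x η v → (c * m) * t * (x * η * v) ≡ (c * (x * t)) * (η * m) * v
    rhs = solve-∀

  -- With e and m the full sizes, the share of picks is m (m - 1) / (e (e - 1)) times (η / ρ)². This
  -- is η′ / ρ′ times (m - 1) η / ((e - 1) ρ), and `slope` evaluates the last factor as κ / w.
  pair-step : ∀ {e m ρ η ρ′ η′} → LevelStep w κ (suc (suc e)) (suc (suc m)) ρ η ρ′ η′ → x₁ * ρ ≡ x * η →
              ((e C m) * (x₁ * x₁) * x ^ m) * ρ′ * w ≡ ((suc (suc e) C suc (suc m)) * x ^ suc (suc m)) * η′ * κ
  pair-step {x₁} {x} {e} {m} {ρ} {η} L eq rewrite LevelStep.ρ′≡ L | LevelStep.η′≡ L =
    ℕₚ.*-cancelʳ-≡ _ _ (suc e * ρ) {{ℕₚ.m*n≢0 (suc e) ρ {{_}} {{>-nonZero (LevelStep.0<ρ L)}}}} (begin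
    ((e C m) * (x₁ * x₁) * x ^ m) * (ρ * suc (suc e)) * w * (suc e * ρ)
      ≡⟨ lhs (e C m) x₁ (x ^ m) ρ (suc (suc e)) w (suc e) ⟩
    suc (suc e) * (suc e * (e C m)) * (x ^ m * w) * (x₁ * ρ * (x₁ * ρ))
      ≡⟨ cong₂ (λ c d → c * (x ^ m * w) * (d * d)) binomials eq ⟩
    ((suc (suc e) C suc (suc m)) * suc (suc m) * suc m) * (x ^ m * w) * (x * η * (x * η))
      ≡⟨ mid (suc (suc e) C suc (suc m)) (suc (suc m)) (suc m) (x ^ m) w x η ⟩
    ((suc (suc e) C suc (suc m)) * x ^ suc (suc m)) * (η * suc (suc m)) * (suc m * η * w)
      ≡⟨ cong ((((suc (suc e) C suc (suc m)) * x ^ suc (suc m)) * (η * suc (suc m))) *_) (LevelStep.slope L) ⟩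
    ((suc (suc e) C suc (suc m)) * x ^ suc (suc m)) * (η * suc (suc m)) * (suc e * ρ * κ)
      ≡⟨ rhs (((suc (suc e) C suc (suc m)) * x ^ suc (suc m)) * (η * suc (suc m))) (suc e) ρ κ ⟩
    ((suc (suc e) C suc (suc m)) * x ^ suc (suc m)) * (η * suc (suc m)) * κ * (suc e * ρ) ∎)
    where
    open ≡-Reasoning
    lhs : ∀ c x₁ t ρ e w e′ → (c * (x₁ * x₁) * t) * (ρ * e) * w * (e′ * ρ) ≡ e * (e′ * c) * (t * w) * (x₁ * ρ * (x₁ * ρ))
    lhs = solve-∀
    mid : ∀ c m m′ t w x η → (c * m * m′) * (t * w) * (x * η * (x * η)) ≡ (c * (x * (x * t))) * (η * m) * (m′ * η * w)
    mid = solve-∀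
    rhs : ∀ c e ρ κ → c * (e * ρ * κ) ≡ c * κ * (e * ρ)
    rhs = solve-∀
    binomials : suc (suc e) * (suc e * (e C m)) ≡ (suc (suc e) C suc (suc m)) * suc (suc m) * suc m
    binomials = begin
      suc (suc e) * (suc e * (e C m))                    ≡⟨ cong (suc (suc e) *_) (absorption e m) ⟨
      suc (suc e) * ((suc e C suc m) * suc m)            ≡⟨ ℕₚ.*-assoc (suc (suc e)) (suc e C suc m) (suc m) ⟨
      suc (suc e) * (suc e C suc m) * suc m              ≡⟨ cong (_* suc m) (absorption (suc e) (suc m)) ⟨
      (suc (suc e) C suc (suc m)) * suc (suc m) * suc m  ∎

  Σ-Pick-diagonal : (P Q : A → Set) (i : Fin n) →
    Σ (Pick A n m) (λ p → Holds P (pickAt p i) × Holds Q (pickAt p i)) ↔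
    Σ (Pick A n m) (λ p → Holds (λ x → P x × Q x) (pickAt p i))
  Σ-Pick-diagonal P Q i = Σ-congˡ {k = bijection} (λ {p} → Holds-∩ P Q (pickAt p i))

  -- One step of the recursion, in which the picks become the new labels. Different heads select two
  -- independent labels, so `pair-step` applies; equal heads require one label to contain both
  -- points, and only this case asks for a count of such labels.
  picksThrough : ∀ {e m ρ η ρ′ η′} → LevelStep w κ e m ρ η ρ′ η′ → {P Q : A → Set} →
    A ↔ Fin x → Σ A P ↔ Fin x₁ → Σ A Q ↔ Fin x₁ → x₁ * ρ ≡ x * η → (a b : Fin e) →
    (∃[ x₁′ ] (Σ (Pick A e m) (λ p → Holds P (pickAt p a)) ↔ Fin x₁′ ×
              Σ (Pick A e m) (λ p → Holds Q (pickAt p b)) ↔ Fin x₁′ ×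
              x₁′ * ρ′ ≡ ((e C m) * x ^ m) * η′)) ×
    ((a ≡ b → ∃[ z ] (Σ A (λ c → P c × Q c) ↔ Fin z × z * ρ * w ≡ x * η * κ)) →
     ∃[ z ] (Σ (Pick A e m) (λ p → Holds P (pickAt p a) × Holds Q (pickAt p b)) ↔ Fin z ×
             z * ρ′ * w ≡ ((e C m) * x ^ m) * η′ * κ))
  picksThrough {A} {x} {x₁} {suc (suc e)} {suc (suc m)} {ρ} {η} {ρ′} {η′}
               L@record { 2≤e = s≤s (s≤s _) ; 2≤m = s≤s (s≤s _) } {P} {Q} A↔ P↔ Q↔ eq a b =
    ( _ , Pick∋-↔ A↔ P↔ (suc e) (suc m) a , Pick∋-↔ A↔ Q↔ (suc e) (suc m) b
    , trans (sym (ℕₚ.*-identityʳ _))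
            (trans (incidence-step {x = x} {z = x₁} L 1 1 (cong (_* 1) eq)) (ℕₚ.*-identityʳ _)) )
    , through
    where
    through : (a ≡ b → ∃[ z ] (Σ A (λ c → P c × Q c) ↔ Fin z × z * ρ * w ≡ x * η * κ)) →
      ∃[ z ] (Σ (Pick A (suc (suc e)) (suc (suc m))) (λ p → Holds P (pickAt p a) × Holds Q (pickAt p b)) ↔ Fin z ×
              z * ρ′ * w ≡ ((suc (suc e) C suc (suc m)) * x ^ suc (suc m)) * η′ * κ)
    through same with a ≟ b
    ... | no a≢b   = _ , Pick∋∋-↔ A↔ P↔ Q↔ e m a b a≢b , pair-step {x₁ = x₁} {x = x} L eq
    ... | yes refl = let _ , PQ↔ , eq′ = same refl in
      _ , Pick∋-↔ A↔ PQ↔ (suc e) (suc m) a ↔-∘ Σ-Pick-diagonal P Q a , incidence-step {x = x} L w κ eq′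

  -- P and Q express that a label contains the initial coordinates of two points, of which p and q are the remaining
  -- ones.  The labels containing both have to be counted in advance only if the points already differ initially.
  treesThrough : (es : Vec ℕ s) (m : Fin s → ℕ) (ρ η : ℕ → ℕ) →
    (∀ j → LevelStep w κ (lookup es j) (m j) (ρ (toℕ j)) (η (toℕ j)) (ρ (suc (toℕ j))) (η (suc (toℕ j)))) →
    {P Q : A → Set} → A ↔ Fin x → Σ A P ↔ Fin x₁ → Σ A Q ↔ Fin x₁ → x₁ * ρ 0 ≡ x * η 0 →
    (p q : Chain.Point es) →
    (p ≡ q → ∃[ z ] (Σ A (λ a → P a × Q a) ↔ Fin z × z * ρ 0 * w ≡ x * η 0 * κ)) →
    ∃[ z ] (Σ (Tree es m A) (λ t → Holds P (treeAt es t p) × Holds Q (treeAt es t q)) ↔ Fin z ×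
            z * ρ s * w ≡ treeCount es m x * η s * κ)
  treesThrough []       m ρ η L A↔ P↔ Q↔ eq []      []       same = same refl
  treesThrough (e ∷ es) m ρ η L {P} {Q} A↔ P↔ Q↔ eq (a ∷ r) (b ∷ r′) same
    with picksThrough (L zero) A↔ P↔ Q↔ eq a b
  ... | (_ , P′↔ , Q′↔ , eq′) , through =
    let z , ↔z , eq″ = treesThrough es (m ∘ suc) (ρ ∘ suc) (η ∘ suc) (L ∘ suc)
                         (Pick-↔ A↔ e (m zero)) P′↔ Q′↔ eq′ r r′ (λ r≡r′ → through (λ a≡b → same (cong₂ _∷_ a≡b r≡r′)))
    in z , ↔z ↔-∘ Σ-congˡ {k = bijection} (λ {t} → ≡⇒
                   (cong₂ _×_ (Holds-! P (treeAt es t r) a) (Holds-! Q (treeAt es t r′) b))) , eq″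

-- Cardinalities and orbits of subsets

hasCardinality : ∀ {a ℓ p} {S : Setoid a ℓ} {X : Pred (Setoid.Carrier S) p} → let open Setoid S in
  (to : ∃ X → Fin n) (from : Fin n → ∃ X) →
  (∀ x y → proj₁ x ≈ proj₁ y → to x ≡ to y) → (∀ i → to (from i) ≡ i) →
  (∀ x → proj₁ (from (to x)) ≈ proj₁ x) → HasCardinality S X n
hasCardinality {S = S} to from to-cong to-from from-to = record
  { to        = to
  ; from      = from
  ; to-cong   = λ {x} {y} → to-cong x y
  ; from-cong = λ { refl → Setoid.refl S }
  ; inverse   = (λ {i} {x} x≈ → trans (to-cong x (from i) x≈) (to-from i))
              , (λ { {x} refl → from-to x })
  }

module _ {P : Set} where

  ^ˢ-∈ : (X : Subset P) (g : Sym P) {p : P} → p ∈ X → g · p ∈ X ^ˢ g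
  ^ˢ-∈ X g p∈X = _ , p∈X , refl

  ^ˢ-cong : {X Y : Subset P} (g : Sym P) → X ≐ Y → X ^ˢ g ≐ Y ^ˢ g
  ^ˢ-cong g (X⊆Y , Y⊆X) = (λ (q , q∈ , eq) → q , X⊆Y q∈ , eq) , (λ (q , q∈ , eq) → q , Y⊆X q∈ , eq)

  ^ˢ-∘ : (X : Subset P) (g h : Sym P) → X ^ˢ g ^ˢ h ≐ X ^ˢ (h ↔-∘ g)
  ^ˢ-∘ X g h = (λ { (_ , (q , q∈ , refl) , eq) → q , q∈ , eq })
             , (λ { (q , q∈ , eq) → g · q , ^ˢ-∈ X g q∈ , eq })

  ^ˢ-inverse : (X : Subset P) (g : Sym P) → X ^ˢ g ^ˢ (↔-sym g) ≐ X
  ^ˢ-inverse X g = (λ { (_ , (q , q∈ , refl) , refl) → subst (_∈ X) (sym (Inverse.strictlyInverseʳ g q)) q∈ })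
                 , (λ {p} p∈ → g · p , ^ˢ-∈ X g p∈ , Inverse.strictlyInverseʳ g p)

  HasCardinality-^ˢ : {X Y : Subset P} (g : Sym P) → Y ≐ X ^ˢ g →
                      HasCardinality (setoid P) X n → HasCardinality (setoid P) Y n
  HasCardinality-^ˢ {X = X} {Y} g (Y⊆ , ⊆Y) X↔ = hasCardinality {S = setoid P}
    (λ (p , p∈) → X.to (pre p (Y⊆ p∈)))
    (λ i → g · proj₁ (X.from i) , ⊆Y (^ˢ-∈ X g (proj₂ (X.from i))))
    (λ (p , p∈) (q , q∈) eq → X.to-cong (trans (pre-≡ p (Y⊆ p∈))
      (trans (cong (Inverse.from g) eq) (sym (pre-≡ q (Y⊆ q∈))))))
    (λ i → trans (X.to-cong (trans (pre-≡ _ (Y⊆ (⊆Y (^ˢ-∈ X g (proj₂ (X.from i))))))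
                                   (Inverse.strictlyInverseʳ g _))) (X.strictlyInverseˡ i))
    (λ (p , p∈) → trans (cong (g ·_) (X.strictlyInverseʳ _)) (proj₂ (proj₂ (Y⊆ p∈))))
    where
    module X = Inverse X↔
    pre : ∀ p → p ∈ X ^ˢ g → ∃ X
    pre p (q , q∈ , _) = q , q∈
    -- Every proof of membership yields the same preimage, so the numbering depends on the point
    -- alone.
    pre-≡ : ∀ p (h : p ∈ X ^ˢ g) → proj₁ (pre p h) ≡ Inverse.from g p
    pre-≡ p (q , _ , refl) = sym (Inverse.strictlyInverseʳ g q)

  module _ {G : Pred (Sym P) 0ℓ} (isGroup : IsPermutationGroup G) (X₀ : Subset P) where

    open IsPermutationGroup isGroup

    orbit-respects : {X Y : Subset P} → X ≐ Y → X ∈ X₀ ^ᴳ G → Y ∈ X₀ ^ᴳ G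
    orbit-respects X≐Y (g , g∈ , X≐) = g , g∈ , ≐-trans (≐-sym X≐Y) X≐

    orbit-closed : {X : Subset P} {g : Sym P} → g ∈ G → X ∈ X₀ ^ᴳ G → X ^ˢ g ∈ X₀ ^ᴳ G
    orbit-closed {g = g} g∈ (h , h∈ , X≐) =
      g ↔-∘ h , compose g∈ h∈ , ≐-trans (^ˢ-cong g X≐) (^ˢ-∘ X₀ h g)

    orbit-automorphismGroup : IsAutomorphismGroup G (X₀ ^ᴳ G)
    orbit-automorphismGroup = record
      { isGroup        = isGroup
      ; isAutomorphism = λ {g} g∈ X → mk⇔ (orbit-closed g∈)
          (orbit-respects (^ˢ-inverse X g) ∘ orbit-closed (inverse g∈))
      }

Wreath-isGroup : (es : Vec ℕ s) → IsPermutationGroup (Chain.Wreath es)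
Wreath-isGroup es = record
  { respects = λ eq g∈ i p q → subst₂ (λ x y → Chain.𝒞 es i p q ⇔ Chain.𝒞 es i x y) (eq p) (eq q) (g∈ i p q)
  ; identity = λ _ _ _ → mk⇔ id id
  ; compose  = λ {g} {h} g∈ h∈ i p q → mk⇔
      (Equivalence.to (g∈ i (h · p) (h · q)) ∘ Equivalence.to (h∈ i p q))
      (Equivalence.from (h∈ i p q) ∘ Equivalence.from (g∈ i (h · p) (h · q)))
  ; inverse  = λ {g} g∈ i p q → let g⁻¹ = Inverse.from g in
      subst₂ (λ x y → Chain.𝒞 es i x y ⇔ Chain.𝒞 es i (g⁻¹ p) (g⁻¹ q))
        (Inverse.strictlyInverseˡ g p) (Inverse.strictlyInverseˡ g q)
        (mk⇔ (Equivalence.from (g∈ i (g⁻¹ p) (g⁻¹ q))) (Equivalence.to (g∈ i (g⁻¹ p) (g⁻¹ q))))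
  }

-- Points, boxes and the initial tree

Point-↔ : (es : Vec ℕ s) → Chain.Point es ↔ Fin (product (toList es))
Point-↔ []       = mk↔ₛ′ (λ _ → zero) (λ _ → []) (λ { zero → refl }) (λ { [] → refl })
Point-↔ (e ∷ es) = (↔-id _ ×ᶠ Point-↔ es) ↔-∘
  mk↔ₛ′ uncons (uncurry _∷_) (λ _ → refl) (λ { (_ ∷ _) → refl })

Box : (es : Vec ℕ s) → (Fin s → ℕ) → Subset (Chain.Point es)
Box es m δ = ∀ j → toℕ (lookup⁺ δ j) < m j

Box-cardinality : (es : Vec ℕ s) (m : Fin s → ℕ) → (∀ j → m j ≤ lookup es j) →
                  HasCardinality (setoid (Chain.Point es)) (Box es m) (product (tabulate m))
Box-cardinality es m m≤e = hasCardinality {S = setoid (Chain.Point es)}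
  (λ (p , h) → to es m p h) (λ i → from es m m≤e i , from-∈ es m m≤e i)
  (λ { _ _ refl → refl }) (to-from es m m≤e) (λ (p , h) → from-to es m m≤e p h)
  where
  -- Membership is an irrelevant argument: its proofs are functions, which cannot be identified
  -- without extensionality, while the number has to depend on the point alone.
  to : (es : Vec ℕ s) (m : Fin s → ℕ) (p : Chain.Point es) → .(Box es m p) → Fin (product (tabulate m))
  to []       m []      h = zero
  to (e ∷ es) m (a ∷ r) h = combine (fromℕ< (h zero)) (to es (m ∘ suc) r (λ j → h (suc j)))

  from : (es : Vec ℕ s) (m : Fin s → ℕ) → (∀ j → m j ≤ lookup es j) → Fin (product (tabulate m)) → Chain.Point es
  from []       m m≤e i = []
  from (e ∷ es) m m≤e i = let a , r = remQuot {m zero} (product (tabulate (m ∘ suc))) i in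
    inject≤ a (m≤e zero) ∷ from es (m ∘ suc) (m≤e ∘ suc) r

  from-∈ : (es : Vec ℕ s) (m : Fin s → ℕ) (m≤e : ∀ j → m j ≤ lookup es j) → ∀ i → from es m m≤e i ∈ Box es m
  from-∈ (e ∷ es) m m≤e i zero    = let a , r = remQuot {m zero} (product (tabulate (m ∘ suc))) i in
    subst (_< m zero) (sym (Finₚ.toℕ-inject≤ a (m≤e zero))) (Finₚ.toℕ<n a)
  from-∈ (e ∷ es) m m≤e i (suc j) = from-∈ es (m ∘ suc) (m≤e ∘ suc) _ j

  to-from : (es : Vec ℕ s) (m : Fin s → ℕ) (m≤e : ∀ j → m j ≤ lookup es j) → ∀ i →
            to es m (from es m m≤e i) (from-∈ es m m≤e i) ≡ i
  to-from []       m m≤e zero = refl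
  to-from (e ∷ es) m m≤e i    = let a , r = remQuot {m zero} (product (tabulate (m ∘ suc))) i in
    trans (cong₂ combine (Finₚ.toℕ-injective (trans (Finₚ.toℕ-fromℕ< _) (Finₚ.toℕ-inject≤ a (m≤e zero))))
                         (to-from es (m ∘ suc) (m≤e ∘ suc) r))
          (Finₚ.combine-remQuot {m zero} (product (tabulate (m ∘ suc))) i)

  from-to : (es : Vec ℕ s) (m : Fin s → ℕ) (m≤e : ∀ j → m j ≤ lookup es j) → ∀ p (h : p ∈ Box es m) →
            from es m m≤e (to es m p h) ≡ p
  from-to []       m m≤e []      h = refl
  from-to (e ∷ es) m m≤e (a ∷ r) h = trans
    (cong (λ (a , r) → inject≤ a (m≤e zero) ∷ from es (m ∘ suc) (m≤e ∘ suc) r)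
          (Finₚ.remQuot-combine (fromℕ< (h zero)) (to es (m ∘ suc) r (h ∘ suc))))
    (cong₂ _∷_ (Finₚ.toℕ-injective (trans (Finₚ.toℕ-inject≤ _ (m≤e zero)) (Finₚ.toℕ-fromℕ< (h zero))))
               (from-to es (m ∘ suc) (m≤e ∘ suc) r (h ∘ suc)))

initialPick : (x : A) → m ≤ n → Pick A n m
initialPick {n = zero}  x z≤n       = []
initialPick {n = suc n} x z≤n       = skip (initialPick x z≤n)
initialPick             x (s≤s m≤n) = take x (initialPick x m≤n)

initialPick-just : (x : A) (m≤n : m ≤ n) (i : Fin n) → toℕ i < m → pickAt (initialPick x m≤n) i ≡ just x
initialPick-just x (s≤s m≤n) zero    _         = refl
initialPick-just x (s≤s m≤n) (suc i) (s≤s i<m) = initialPick-just x m≤n i i<m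

initialPick-< : (x : A) (m≤n : m ≤ n) (i : Fin n) → is-just (pickAt (initialPick x m≤n) i) ≡ true → toℕ i < m
initialPick-< x z≤n       zero    ()
initialPick-< x z≤n       (suc i) eq with () ← initialPick-< x z≤n i eq
initialPick-< x (s≤s m≤n) zero    _  = s≤s z≤n
initialPick-< x (s≤s m≤n) (suc i) eq = s≤s (initialPick-< x m≤n i eq)

initialTree : (es : Vec ℕ s) {m : Fin s → ℕ} → (∀ j → m j ≤ lookup es j) → A → Tree es m A
initialTree []       m≤e x = x
initialTree (e ∷ es) m≤e x = initialTree es (m≤e ∘ suc) (initialPick x (m≤e zero))

initialTree-just : (es : Vec ℕ s) {m : Fin s → ℕ} (m≤e : ∀ j → m j ≤ lookup es j) (x : A) →
                   ∀ p → p ∈ Box es m → treeAt es (initialTree es m≤e x) p ≡ just x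
initialTree-just []       m≤e x []      h = refl
initialTree-just (e ∷ es) m≤e x (a ∷ r) h = trans
  (cong (_! a) (initialTree-just es (m≤e ∘ suc) (initialPick x (m≤e zero)) r (h ∘ suc)))
  (initialPick-just x (m≤e zero) a (h zero))

initialTree-Box : (es : Vec ℕ s) {m : Fin s → ℕ} (m≤e : ∀ j → m j ≤ lookup es j) (x : A) →
                  ∀ p → is-just (treeAt es (initialTree es m≤e x) p) ≡ true → p ∈ Box es m
initialTree-Box (e ∷ es) {m} m≤e x (a ∷ r) eq = λ { zero → a<m ; (suc j) → r∈ j }
  where
  x′ = initialPick x (m≤e zero)
  r∈ : r ∈ Box es (m ∘ suc)
  r∈ = initialTree-Box es (m≤e ∘ suc) x′ r (is-just-! (treeAt es (initialTree es (m≤e ∘ suc) x′) r) a eq)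
  a<m : toℕ a < m zero
  -- Once `r` is known to lie in the box, the pick over it is `x′`, whose support bounds `a`.
  a<m = initialPick-< x (m≤e zero) a (subst (λ y → is-just (y ! a) ≡ true)
          (initialTree-just es (m≤e ∘ suc) x′ r r∈) eq)

tree-nonempty : (es : Vec ℕ s) {m : Fin s → ℕ} → (∀ j → 1 ≤ m j) → (t : Tree es m A) →
                ∃[ p ] ∃[ x ] treeAt es t p ≡ just x
tree-nonempty []       1≤m t = [] , t , refl
tree-nonempty (e ∷ es) 1≤m t =
  let r , p , t[r] = tree-nonempty es (1≤m ∘ suc) t
      a , x , p[a] = pick-nonempty (1≤m zero) p
  in a ∷ r , x , trans (cong (_! a) t[r]) p[a]

-- The instance of `alignTrees` with mⱼ = eⱼ, where one tree contains every point.
Wreath-transitive : (es : Vec ℕ s) (p q : Chain.Point es) → ∃[ g ] g ∈ Chain.Wreath es × g · p ≡ q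
Wreath-transitive es p q = let g , g∈ , gp≡q , _ = alignTrees es everything everything p q (everywhere p) (everywhere q)
                           in g , g∈ , gp≡q
  where
  everything : Tree es (lookup es) ⊤
  everything = initialTree es (λ _ → ℕₚ.≤-refl) tt
  everywhere : ∀ p → is-just (treeAt es everything p) ≡ true
  everywhere p = cong is-just (initialTree-just es (λ _ → ℕₚ.≤-refl) tt p (λ j → Finₚ.toℕ<n (lookup⁺ p j)))

-- The orbit of the box as the set of trees

⟦_⟧ : {es : Vec ℕ s} {m : Fin s → ℕ} → Tree es m ⊤ → Subset (Chain.Point es)
⟦_⟧ {es = es} t p = Holds (λ _ → ⊤) (treeAt es t p)

Holds⇒just : (x : Maybe A) → Holds (λ _ → ⊤) x → is-just x ≡ true
Holds⇒just (just _) _ = refl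

just⇒Holds : (x : Maybe A) → is-just x ≡ true → Holds (λ _ → ⊤) x
just⇒Holds (just _) _ = tt

Holds-irrelevant : (x : Maybe A) (h h′ : Holds (λ _ → ⊤) x) → h ≡ h′
Holds-irrelevant (just _) _ _ = refl

-- Labels in `⊤` carry no information, so the support already determines all values of the tree.
⟦⟧-injective : (es : Vec ℕ s) {m : Fin s → ℕ} → (∀ j → 1 ≤ m j) → (t u : Tree es m ⊤) → ⟦ t ⟧ ≐ ⟦ u ⟧ → t ≡ u
⟦⟧-injective es 1≤m t u (t⊆u , u⊆t) = treeAt-injective es 1≤m t u λ p →
  go (treeAt es t p) (treeAt es u p) (t⊆u {p}) (u⊆t {p})
  where
  go : (x y : Maybe ⊤) → (Holds (λ _ → ⊤) x → Holds (λ _ → ⊤) y) → (Holds (λ _ → ⊤) y → Holds (λ _ → ⊤) x) → x ≡ y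
  go nothing  nothing  _ _ = refl
  go nothing  (just _) _ g = ⊥-elim (g tt)
  go (just _) nothing  f _ = ⊥-elim (f tt)
  go (just _) (just _) _ _ = refl

-- `X₀` agrees with the box only up to `≐`, since `B` is defined by inequalities between rationals.
module BoxOrbit (es : Vec ℕ s) (0<e : All (0 <_) es) (m : Fin s → ℕ)
                (1≤m : ∀ j → 1 ≤ m j) (m≤e : ∀ j → m j ≤ lookup es j)
                (X₀ : Subset (Chain.Point es)) (X₀≐Box : X₀ ≐ Box es m) where

  Block : Pred (Subset (Chain.Point es)) 0ℓ
  Block = X₀ ^ᴳ Chain.Wreath es

  private
    t₀ : Tree es m ⊤
    t₀ = initialTree es m≤e tt

  align : (t u : Tree es m ⊤) {p q : Chain.Point es} → p ∈ ⟦ t ⟧ → q ∈ ⟦ u ⟧ →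
          ∃[ g ] g ∈ Chain.Wreath es × g · p ≡ q × ⟦ t ⟧ ^ˢ g ≐ ⟦ u ⟧
  align t u {p} {q} p∈ q∈ with alignTrees es t u p q (Holds⇒just _ p∈) (Holds⇒just _ q∈)
  ... | g , g∈ , gp≡q , eq = g , g∈ , gp≡q
    , (λ { (x , x∈ , refl) → just⇒Holds _ (trans (sym (eq x)) (Holds⇒just _ x∈)) })
    , (λ {y} y∈ → Inverse.from g y
        , just⇒Holds _ (trans (eq _)
            (trans (cong (is-just ∘ treeAt es u) (Inverse.strictlyInverseˡ g y)) (Holds⇒just _ y∈)))
        , Inverse.strictlyInverseˡ g y)

  t₀≐X₀ : ⟦ t₀ ⟧ ≐ X₀
  t₀≐X₀ = ≐-trans
    ( (λ {p} p∈ → initialTree-Box es m≤e tt p (Holds⇒just (treeAt es t₀ p) p∈))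
    , (λ {p} p∈ → just⇒Holds (treeAt es t₀ p) (cong is-just (initialTree-just es m≤e tt p p∈))))
    (≐-sym X₀≐Box)

  -- Both trees contain a point because mⱼ ≥ 1, so transitivity on flags carries `t₀` to `t`.
  tree-Block : (t : Tree es m ⊤) → ⟦ t ⟧ ∈ Block
  tree-Block t =
    let p , _ , p∈ = tree-nonempty es 1≤m t₀
        q , _ , q∈ = tree-nonempty es 1≤m t
        g , g∈ , _ , eq = align t₀ t (just⇒Holds (treeAt es t₀ p) (cong is-just p∈))
                                     (just⇒Holds (treeAt es t q) (cong is-just q∈))
    in g , g∈ , ≐-trans (≐-sym eq) (^ˢ-cong g t₀≐X₀)

  Block-tree : {X : Subset (Chain.Point es)} → X ∈ Block → ∃ λ (t : Tree es m ⊤) → X ≐ ⟦ t ⟧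
  Block-tree (g , g∈ , X≐) with permuteTree es 0<e {g} g∈ t₀
  ... | u , eq = u , ≐-trans X≐ (≐-trans (^ˢ-cong g (≐-sym t₀≐X₀))
    ( (λ { (x , x∈ , refl) → subst (Holds _) (sym (eq x)) x∈ })
    , (λ {y} y∈ → Inverse.from g y
        , subst (Holds _) (trans (cong (treeAt es u) (sym (Inverse.strictlyInverseˡ g y))) (eq _)) y∈
        , Inverse.strictlyInverseˡ g y)))

  X₀-Block : X₀ ∈ Block
  X₀-Block = ↔-id _ , IsPermutationGroup.identity (Wreath-isGroup es) , (λ p∈ → _ , p∈ , refl) , (λ { (_ , p∈ , refl) → p∈ })

  automorphismGroup : IsAutomorphismGroup (Chain.Wreath es) Block
  automorphismGroup = orbit-automorphismGroup (Wreath-isGroup es) X₀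

  flagTransitive : IsFlagTransitive (Chain.Wreath es) Block
  flagTransitive = record
    { isAutomorphismGroup = automorphismGroup
    ; transitive = λ X∈ p∈X Y∈ q∈Y →
        let t , X≐t = Block-tree X∈
            u , Y≐u = Block-tree Y∈
            g , g∈ , gp≡q , eq = align t u (proj₁ X≐t p∈X) (proj₁ Y≐u q∈Y)
        in g , g∈ , gp≡q , ≐-trans (^ˢ-cong g X≐t) (≐-trans eq (≐-sym Y≐u))
    }

  chainImprimitive : IsChainImprimitive (Chain.Wreath es) (Chain.𝒞 es) Block
  chainImprimitive = record
    { isAutomorphismGroup = automorphismGroup
    ; transitive          = Wreath-transitive es
    ; invariant           = id
    }

  Block-cardinality : {X : Subset (Chain.Point es)} → X ∈ Block →
                      HasCardinality (setoid (Chain.Point es)) X (product (tabulate m))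
  Block-cardinality (g , _ , X≐) = HasCardinality-^ˢ g (≐-trans X≐ (^ˢ-cong g X₀≐Box)) (Box-cardinality es m m≤e)

  -- Blocks are counted up to `≐` and trees up to `≡`. By `⟦⟧-injective` the tree of a block does
  -- not depend on the group element that presents the block.
  blocksThrough : ∀ p q → Σ (Tree es m ⊤) (λ t → p ∈ ⟦ t ⟧ × q ∈ ⟦ t ⟧) ↔ Fin n →
                  HasCardinality (≐-setoid (Chain.Point es) 0ℓ) (λ X → X ∈ Block × p ∈ X × q ∈ X) n
  blocksThrough {n} p q ↔n = hasCardinality {S = ≐-setoid (Chain.Point es) 0ℓ}
    (λ x → ↔n.to (tree x))
    (λ i → let t , h = ↔n.from i in ⟦ t ⟧ , tree-Block t , h)
    (λ x y X≐Y → cong ↔n.to (tree-cong x y X≐Y))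
    (λ i → trans (cong ↔n.to (Σ-≡ (⟦⟧-injective es 1≤m _ _ (≐-sym (proj₂ (Block-tree (tree-Block (proj₁ (↔n.from i)))))))))
                 (↔n.strictlyInverseˡ i))
    (λ x@(X , X∈ , _) → ≐-trans (≡⇒≐ (cong proj₁ (↔n.strictlyInverseʳ (tree x)))) (≐-sym (proj₂ (Block-tree X∈))))
    where
    module ↔n = Inverse ↔n
    T = Σ (Tree es m ⊤) (λ t → p ∈ ⟦ t ⟧ × q ∈ ⟦ t ⟧)
    Σ-≡ : {x y : T} → proj₁ x ≡ proj₁ y → x ≡ y
    Σ-≡ {t , hp , hq} {_ , hp′ , hq′} refl =
      cong₂ (λ a b → t , a , b) (Holds-irrelevant (treeAt es t p) hp hp′) (Holds-irrelevant (treeAt es t q) hq hq′)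
    ≡⇒≐ : {t u : Tree es m ⊤} → t ≡ u → ⟦ t ⟧ ≐ ⟦ u ⟧
    ≡⇒≐ refl = id , id
    tree : ∃ (λ X → X ∈ Block × p ∈ X × q ∈ X) → T
    tree (X , X∈ , p∈ , q∈) = let t , X⊆t , _ = Block-tree X∈ in t , X⊆t p∈ , X⊆t q∈
    tree-cong : ∀ x y → proj₁ x ≐ proj₁ y → tree x ≡ tree y
    tree-cong (X , X∈ , _) (Y , Y∈ , _) X≐Y = Σ-≡ (⟦⟧-injective es 1≤m _ _
      (≐-trans (≐-sym (proj₂ (Block-tree X∈))) (≐-trans X≐Y (proj₂ (Block-tree Y∈)))))

-- From rationals to natural numbers

fromℚᵘ-homo-+ : ∀ p q → fromℚᵘ p ℚ.+ fromℚᵘ q ≡ fromℚᵘ (p ℚᵘ.+ q)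
fromℚᵘ-homo-+ p q = ℚₚ.toℚᵘ-injective (ℚᵘₚ.≃-trans (ℚₚ.toℚᵘ-homo-+ (fromℚᵘ p) (fromℚᵘ q))
  (ℚᵘₚ.≃-trans (ℚᵘₚ.+-cong (ℚₚ.toℚᵘ-fromℚᵘ p) (ℚₚ.toℚᵘ-fromℚᵘ q)) (ℚᵘₚ.≃-sym (ℚₚ.toℚᵘ-fromℚᵘ (p ℚᵘ.+ q)))))

fromℚᵘ-homo-* : ∀ p q → fromℚᵘ p ℚ.* fromℚᵘ q ≡ fromℚᵘ (p ℚᵘ.* q)
fromℚᵘ-homo-* p q = ℚₚ.toℚᵘ-injective (ℚᵘₚ.≃-trans (ℚₚ.toℚᵘ-homo-* (fromℚᵘ p) (fromℚᵘ q))
  (ℚᵘₚ.≃-trans (ℚᵘₚ.*-cong (ℚₚ.toℚᵘ-fromℚᵘ p) (ℚₚ.toℚᵘ-fromℚᵘ q)) (ℚᵘₚ.≃-sym (ℚₚ.toℚᵘ-fromℚᵘ (p ℚᵘ.* q)))))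

ι : ℕ → ℚ
ι n = + n ℚ./ 1

ι-homo-* : ∀ a b → ι a ℚ.* ι b ≡ ι (a * b)
ι-homo-* a b = trans (fromℚᵘ-homo-* (mkℚᵘ (+ a) 0) (mkℚᵘ (+ b) 0)) (cong (ℚ._/ 1) (sym (ℤₚ.pos-* a b)))

ι-suc-1 : ∀ m → ι (suc m) ℚ.- 1ℚ ≡ ι m
ι-suc-1 m = trans (fromℚᵘ-homo-+ (mkℚᵘ (+ suc m) 0) (mkℚᵘ -[1+ 0 ] 0))
                  (cong (ℚ._/ 1) (cong (ℤ._+ -[1+ 0 ]) (ℤₚ.*-identityʳ (+ suc m))))

ι-≤ : ∀ {a b} → (ι a ℚ.≤ ι b) ⇔ (a ≤ b)
ι-≤ {a} {b} = mk⇔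
  (λ a≤b → drop (ℚᵘₚ.≤-respˡ-≃ (ℚₚ.toℚᵘ-fromℚᵘ a′) (ℚᵘₚ.≤-respʳ-≃ (ℚₚ.toℚᵘ-fromℚᵘ b′) (ℚₚ.toℚᵘ-mono-≤ a≤b))))
  (λ a≤b → ℚₚ.toℚᵘ-cancel-≤ (ℚᵘₚ.≤-respˡ-≃ (ℚᵘₚ.≃-sym (ℚₚ.toℚᵘ-fromℚᵘ a′))
             (ℚᵘₚ.≤-respʳ-≃ (ℚᵘₚ.≃-sym (ℚₚ.toℚᵘ-fromℚᵘ b′)) (*≤* (ℤₚ.*-monoʳ-≤-nonNeg (+ 1) (+≤+ a≤b))))))
  where
  a′ = mkℚᵘ (+ a) 0
  b′ = mkℚᵘ (+ b) 0
  drop : a′ ℚᵘ.≤ b′ → a ≤ b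
  drop (*≤* a≤b) = ℤₚ.drop‿+≤+ (subst₂ ℤ._≤_ (ℤₚ.*-identityʳ (+ a)) (ℤₚ.*-identityʳ (+ b)) a≤b)

ι≤-1⇔< : ∀ {r} a m → 1 ≤ m → r ≡ ι m → (ι a ℚ.≤ r ℚ.- 1ℚ) ⇔ (a < m)
ι≤-1⇔< a (suc m) _ refl rewrite ι-suc-1 m =
  mk⇔ (s≤s ∘ Equivalence.to ι-≤) (λ { (s≤s a≤m) → Equivalence.from ι-≤ a≤m })

÷-unique : ∀ {p q} r .{{_ : ℚ.NonZero q}} → p ≡ r ℚ.* q → p ÷ q ≡ r
÷-unique {q = q} r refl = trans (ℚₚ.*-assoc r q (ℚ.1/ q)) (trans (cong (r ℚ.*_) (ℚₚ.*-inverseʳ q)) (ℚₚ.*-identityʳ r))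

ι≡/ : ∀ a b d .{{_ : NonZero d}} → a * d ≡ b → ι a ≡ + b ℚ./ d
ι≡/ a b (suc d) refl = ℚₚ.fromℚᵘ-cong {mkℚᵘ (+ a) 0} {mkℚᵘ (+ (a * suc d)) d}
  (*≡* (trans (sym (ℤₚ.pos-* a (suc d))) (sym (ℤₚ.*-identityʳ (+ (a * suc d))))))

module _ (κ w π : ℕ) .{{_ : NonZero w}} where

  affine : ℚ
  affine = 1ℚ ℚ.+ (+ κ ℚ./ w) ℚ.* (+ π ℚ./ 1)

  affine≡/ : affine ≡ + (w + κ * π) ℚ./ w
  affine≡/ = go w
    where
    go : ∀ w .{{_ : NonZero w}} → 1ℚ ℚ.+ (+ κ ℚ./ w) ℚ.* (+ π ℚ./ 1) ≡ + (w + κ * π) ℚ./ w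
    go (suc w) = begin
      1ℚ ℚ.+ fromℚᵘ κ/w ℚ.* fromℚᵘ π/1  ≡⟨ cong (1ℚ ℚ.+_) (fromℚᵘ-homo-* κ/w π/1) ⟩
      1ℚ ℚ.+ fromℚᵘ (κ/w ℚᵘ.* π/1)      ≡⟨ fromℚᵘ-homo-+ ℚᵘ.1ℚᵘ (κ/w ℚᵘ.* π/1) ⟩
      fromℚᵘ (ℚᵘ.1ℚᵘ ℚᵘ.+ κ/w ℚᵘ.* π/1) ≡⟨ ℚₚ.fromℚᵘ-cong {ℚᵘ.1ℚᵘ ℚᵘ.+ κ/w ℚᵘ.* π/1} {mkℚᵘ (+ (suc w + κ * π)) w}
                                                           (*≡* eq) ⟩
      fromℚᵘ (mkℚᵘ (+ (suc w + κ * π)) w) ∎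
      where
      open ≡-Reasoning
      κ/w = mkℚᵘ (+ κ) w
      π/1 = mkℚᵘ (+ π) 0
      eq : ℚᵘ.↥ (ℚᵘ.1ℚᵘ ℚᵘ.+ κ/w ℚᵘ.* π/1) ℤ.* + suc w ≡ + (suc w + κ * π) ℤ.* ℚᵘ.↧ (ℚᵘ.1ℚᵘ ℚᵘ.+ κ/w ℚᵘ.* π/1)
      eq = begin
        (+ 1 ℤ.* ℚᵘ.↧ (κ/w ℚᵘ.* π/1) ℤ.+ + κ ℤ.* + π ℤ.* + 1) ℤ.* + suc w
          ≡⟨ cong (λ d → (+ 1 ℤ.* d ℤ.+ + κ ℤ.* + π ℤ.* + 1) ℤ.* + suc w) ↧≡ ⟩
        (+ 1 ℤ.* + suc w ℤ.+ + κ ℤ.* + π ℤ.* + 1) ℤ.* + suc w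
          ≡⟨ cong (ℤ._* + suc w) (cong₂ ℤ._+_ (ℤₚ.*-identityˡ (+ suc w)) (ℤₚ.*-identityʳ (+ κ ℤ.* + π))) ⟩
        (+ suc w ℤ.+ + κ ℤ.* + π) ℤ.* + suc w
          ≡⟨ cong₂ (λ c d → (+ suc w ℤ.+ c) ℤ.* d) (sym (ℤₚ.pos-* κ π))
                    (sym (trans (cong (λ d → + suc d) (ℕₚ.+-identityʳ _)) ↧≡)) ⟩
        + (suc w + κ * π) ℤ.* ℚᵘ.↧ (ℚᵘ.1ℚᵘ ℚᵘ.+ κ/w ℚᵘ.* π/1) ∎
        where
        ↧≡ : ℚᵘ.↧ (κ/w ℚᵘ.* π/1) ≡ + suc w
        ↧≡ = cong (λ d → + suc d) (ℕₚ.*-identityʳ w)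

  affine-natural : ∀ y → y * w ≡ w + κ * π → affine ≡ ι y
  affine-natural y eq = trans affine≡/ (sym (ι≡/ y _ w eq))

  -- The other side of the cross-multiplied equation is a natural number, so taking absolute values
  -- disposes of the sign of `z`.
  affine-integral : ∀ z → affine ≡ z ℚ./ 1 → ∣ z ∣ * w ≡ w + κ * π
  affine-integral z eq = go w (trans (sym eq) affine≡/)
    where
    go : ∀ w .{{_ : NonZero w}} → z ℚ./ 1 ≡ + (w + κ * π) ℚ./ w → ∣ z ∣ * w ≡ w + κ * π
    go (suc w) eq with ℚₚ./-injective-≃ (mkℚᵘ z 0) (mkℚᵘ (+ (suc w + κ * π)) w) eq
    ... | *≡* eq′ = begin
      ∣ z ∣ * suc w                      ≡⟨ ℤₚ.abs-* z (+ suc w) ⟨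
      ∣ z ℤ.* + suc w ∣                  ≡⟨ cong ∣_∣ eq′ ⟩
      ∣ + (suc w + κ * π) ℤ.* + 1 ∣      ≡⟨ cong ∣_∣ (ℤₚ.*-identityʳ (+ (suc w + κ * π))) ⟩
      suc w + κ * π                      ∎
      where open ≡-Reasoning

-- Products of the block parameters

-- The product of the entries after the j-th. For `μ` it is k / yⱼ, the number of 𝒞ⱼ-classes that a
-- block meets.
cofactor : (Fin s → ℕ) → Fin s → ℕ
cofactor m zero    = product (tabulate (m ∘ suc))
cofactor m (suc j) = cofactor (m ∘ suc) j

module _ where

  private
    shift : ∀ η₀ η₁ m₀ p → η₁ ≡ η₀ * m₀ → η₁ * p ≡ η₀ * (m₀ * p)
    shift η₀ _ m₀ p refl = ℕₚ.*-assoc η₀ m₀ p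

  partialProduct-cofactor : (m : Fin s → ℕ) (η : ℕ → ℕ) → (∀ j → η (suc (toℕ j)) ≡ η (toℕ j) * m j) →
                            ∀ j → η (suc (toℕ j)) * cofactor m j ≡ η 0 * product (tabulate m)
  partialProduct-cofactor m η eq zero    = shift (η 0) (η 1) (m zero) _ (eq zero)
  partialProduct-cofactor m η eq (suc j) =
    trans (partialProduct-cofactor (m ∘ suc) (η ∘ suc) (eq ∘ suc) j) (shift (η 0) (η 1) (m zero) _ (eq zero))

  partialProduct-last : (m : Fin s → ℕ) (η : ℕ → ℕ) → (∀ j → η (suc (toℕ j)) ≡ η (toℕ j) * m j) →
                        η s ≡ η 0 * product (tabulate m)
  partialProduct-last {zero}  m η eq = sym (ℕₚ.*-identityʳ (η 0))
  partialProduct-last {suc s} m η eq =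
    trans (partialProduct-last (m ∘ suc) (η ∘ suc) (eq ∘ suc)) (shift (η 0) (η 1) (m zero) _ (eq zero))

^-distribʳ-* : ∀ a b n → (a * b) ^ n ≡ a ^ n * b ^ n
^-distribʳ-* a b zero    = refl
^-distribʳ-* a b (suc n) = trans (cong (a * b *_) (^-distribʳ-* a b n)) (interchange a b (a ^ n) (b ^ n))
  where
  interchange : ∀ a b c d → a * b * (c * d) ≡ a * c * (b * d)
  interchange = solve-∀

-- A tree makes an independent choice of mⱼ among eⱼ parts in each of `cofactor m j` classes, and
-- assigns one of `x` labels to each of its points.
treeCount-product : (es : Vec ℕ s) (m : Fin s → ℕ) (x : ℕ) →
  treeCount es m x ≡ product (tabulate λ j → (lookup es j C m j) ^ cofactor m j) * x ^ product (tabulate m)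
treeCount-product []       m x = sym (trans (ℕₚ.+-identityʳ (x * 1)) (ℕₚ.*-identityʳ x))
treeCount-product (e ∷ es) m x = begin
  treeCount es (m ∘ suc) (c * x ^ m zero)
    ≡⟨ treeCount-product es (m ∘ suc) (c * x ^ m zero) ⟩
  b * (c * x ^ m zero) ^ p
    ≡⟨ cong (b *_) (^-distribʳ-* c (x ^ m zero) p) ⟩
  b * (c ^ p * (x ^ m zero) ^ p)
    ≡⟨ cong (λ z → b * (c ^ p * z)) (ℕₚ.^-*-assoc x (m zero) p) ⟩
  b * (c ^ p * x ^ (m zero * p))
    ≡⟨ regroup b (c ^ p) (x ^ (m zero * p)) ⟩
  c ^ p * b * x ^ (m zero * p) ∎
  where
  open ≡-Reasoning
  c = e C m zero
  p = product (tabulate (m ∘ suc))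
  b = product (tabulate λ j → (lookup es j C m (suc j)) ^ cofactor (m ∘ suc) j)
  regroup : ∀ b c z → b * (c * z) ≡ c * b * z
  regroup = solve-∀

-- Arithmetic of prefix products and of y

prefix-suc : (e : Vec ℕ s) (j : Fin s) →
             Chain.prefix e (suc (toℕ j)) ≡ Chain.prefix e (toℕ j) * lookup e j
prefix-suc (e₁ ∷ e) zero    = ℕₚ.*-comm e₁ 1
prefix-suc (e₁ ∷ e) (suc j) = trans (cong (e₁ *_) (prefix-suc e j)) (sym (ℕₚ.*-assoc e₁ (Chain.prefix e (toℕ j)) (lookup e j)))

prefix-last : (e : Vec ℕ s) → Chain.prefix e s ≡ Chain.v e
prefix-last []       = refl
prefix-last (e₁ ∷ e) = cong (e₁ *_) (prefix-last e)

prefix-positive : (e : Vec ℕ s) → All (0 <_) e → ∀ i → 0 < Chain.prefix e i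
prefix-positive e        0<e         zero    = s≤s z≤n
prefix-positive []       []          (suc i) = s≤s z≤n
prefix-positive (e₁ ∷ e) (0<e₁ ∷ 0<e) (suc i) = ℕₚ.*-mono-≤ 0<e₁ (prefix-positive e 0<e i)

d∣e-1 : (e : Vec ℕ s) (j : Fin s) → Chain.d e ∣ lookup e j ∸ 1
d∣e-1 (e₁ ∷ e) zero    = gcd[m,n]∣m (e₁ ∸ 1) (Chain.d e)
d∣e-1 (e₁ ∷ e) (suc j) = ∣-trans (gcd[m,n]∣n (e₁ ∸ 1) (Chain.d e)) (d∣e-1 e j)

-- The left side exceeds y w by c y (t w) = κ (c y d) = κ (e - 1) ρ, which is what raises ρ - 1 to ρ
-- e - 1 on the right.
next-y : ∀ {κ d t w y ρ c e} → 1 ≤ ρ → 1 ≤ e → κ * d ≡ t * w → y * w ≡ w + κ * (ρ ∸ 1) → c * y * d ≡ (e ∸ 1) * ρ →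
         y * suc (t * c) * w ≡ w + κ * (ρ * e ∸ 1)
next-y {κ} {d} {t} {w} {y} {suc ρ} {c} {suc e} _ _ κd≡tw yw≡ cyd≡ = begin
  y * suc (t * c) * w                 ≡⟨ expand y t c w ⟩
  y * w + c * y * (t * w)             ≡⟨ cong (λ z → y * w + c * y * z) κd≡tw ⟨
  y * w + c * y * (κ * d)             ≡⟨ swap (y * w) (c * y) κ d ⟩
  y * w + κ * (c * y * d)             ≡⟨ cong₂ (λ a b → a + κ * b) yw≡ cyd≡ ⟩
  w + κ * ρ + κ * (e * suc ρ)         ≡⟨ collect w κ ρ e ⟩
  w + κ * (e + ρ * suc e)             ∎
  where
  open ≡-Reasoning
  expand : ∀ y t c w → y * suc (t * c) * w ≡ y * w + c * y * (t * w)
  expand = solve-∀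
  swap : ∀ a b κ d → a + b * (κ * d) ≡ a + κ * (b * d)
  swap = solve-∀
  collect : ∀ w κ ρ e → w + κ * ρ + κ * (e * suc ρ) ≡ w + κ * (e + ρ * suc e)
  collect = solve-∀

y-slope : ∀ {κ d t w y ρ c e} → κ * d ≡ t * w → c * y * d ≡ e * ρ → t * c * y * w ≡ e * ρ * κ
y-slope {κ} {d} {t} {w} {y} {ρ} {c} {e} κd≡tw cyd≡ = begin
  t * c * y * w    ≡⟨ left t c y w ⟩
  c * y * (t * w)  ≡⟨ cong (c * y *_) κd≡tw ⟨
  c * y * (κ * d)  ≡⟨ right (c * y) κ d ⟩
  c * y * d * κ    ≡⟨ cong (_* κ) cyd≡ ⟩
  e * ρ * κ        ∎
  where
  open ≡-Reasoning
  left : ∀ t c y w → t * c * y * w ≡ c * y * (t * w)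
  left = solve-∀
  right : ∀ a κ d → a * (κ * d) ≡ a * d * κ
  right = solve-∀

distinct-points : {e : Vec ℕ s} → 1 ≤ s → All (2 ≤_) e →
                  Σ (Chain.Point e) λ p → Σ (Chain.Point e) λ q → p ≢ q
distinct-points _ (s≤s (s≤s _) ∷ 2≤e) = zero ∷ origin 2≤e , suc zero ∷ origin 2≤e , λ ()
  where
  origin : ∀ {n} {e : Vec ℕ n} → All (2 ≤_) e → Chain.Point e
  origin = All.map λ { (s≤s _) → zero }

-- The design for the given parameters

module Parameters {s : ℕ} (e : Vec ℕ s) (k : ℕ)
  (2≤s : 2 ≤ s) (2≤e : All (2 ≤_) e) (1<k : 1 < k) (k<v : k < Chain.v e) where

  open Construction e k 2≤s 2≤e 1<k k<v

  w κ : ℕ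
  w = v ∸ 1
  κ = k ∸ 1

  -- yᵢ rounded down
  Y : ℕ → ℕ
  Y i = (w + κ * (prefix i ∸ 1)) / w

  -- `Y` is a total function on naturals, so the integrality of yᵢ becomes this separate equation.
  Exact : ℕ → Set
  Exact i = Y i * w ≡ w + κ * (prefix i ∸ 1)

  Y-unique : ∀ i y → y * w ≡ w + κ * (prefix i ∸ 1) → Y i ≡ y
  Y-unique i y eq = trans (cong (_/ w) (sym eq)) (m*n/n≡m y w)

  Y-exact : ∀ i y → y * w ≡ w + κ * (prefix i ∸ 1) → Exact i
  Y-exact i y eq = trans (cong (_* w) (Y-unique i y eq)) eq

  Y-zero : 1 * w ≡ w + κ * (prefix 0 ∸ 1)
  Y-zero = cong (λ z → w + z) (sym (ℕₚ.*-zeroʳ κ))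

  Y₀≡1 : Y 0 ≡ 1
  Y₀≡1 = Y-unique 0 1 Y-zero

  y≡ιY : ∀ i → Exact i → y i ≡ ι (Y i)
  y≡ιY zero    _     = cong ι (sym Y₀≡1)
  y≡ιY (suc i) exact = affine-natural κ w (prefix (suc i) ∸ 1) (Y (suc i)) exact

  -- The assumption begins at i = 1; at i = 0 the value 1 divides everything.
  Y-integral : ∀ i {n} → (1 ≤ i → y i IsIntegerDividing n) → Exact i × Y i ∣ n
  Y-integral zero    {n} _   = Y-exact 0 1 Y-zero , subst (_∣ n) (sym Y₀≡1) (1∣ n)
  Y-integral (suc i) {n} hyp =
    let z , eq , z∣n = hyp (s≤s z≤n)
        ∣z∣w≡ = affine-integral κ w (prefix (suc i) ∸ 1) z eq
    in Y-exact (suc i) ∣ z ∣ ∣z∣w≡ , subst (_∣ n) (sym (Y-unique (suc i) ∣ z ∣ ∣z∣w≡)) z∣n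

  suc-κ : suc κ ≡ k
  suc-κ = ℕₚ.m+[n∸m]≡n (ℕₚ.<⇒≤ 1<k)

  Y-last : Y s ≡ k
  Y-last = Y-unique s k (begin
    k * w                         ≡⟨ cong (_* w) suc-κ ⟨
    w + κ * w                     ≡⟨ cong (λ ρ → w + κ * (ρ ∸ 1)) (prefix-last e) ⟨
    w + κ * (prefix s ∸ 1)        ∎)
    where open ≡-Reasoning

  κ≤w : κ ≤ w
  κ≤w = ℕₚ.∸-monoˡ-≤ 1 (ℕₚ.<⇒≤ k<v)

  0<κ : 0 < κ
  0<κ = ℕₚ.m<n⇒0<n∸m 1<k

  0<e : All (0 <_) e
  0<e = All.map (ℕₚ.≤-trans (s≤s z≤n)) 2≤e

  module _ (w∣κd : w ∣ κ * d)
           (divisibility : ∀ (i : Fin s) → 1 ≤ toℕ i →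
                           y (toℕ i) IsIntegerDividing (((lookup e i ∸ 1) * prefix (toℕ i)) / d)) where

    private
      t : ℕ
      t = quotient w∣κd
      exact : ∀ j → Exact (toℕ j)
      exact j = proj₁ (Y-integral (toℕ j) (divisibility j))
      c : Fin s → ℕ
      c j = quotient (proj₂ (Y-integral (toℕ j) (divisibility j)))
      κd≡tw : κ * d ≡ t * w
      κd≡tw = _∣_.equality w∣κd
      0<ρ : ∀ i → 0 < prefix i
      0<ρ = prefix-positive e 0<e
      -- The natural division by `d` is exact because `d` divides each eⱼ - 1.
      cYd≡ : ∀ j → c j * Y (toℕ j) * d ≡ (lookup e j ∸ 1) * prefix (toℕ j)
      cYd≡ j = trans (cong (_* d) (sym (_∣_.equality (proj₂ (Y-integral (toℕ j) (divisibility j))))))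
                     (m/n*n≡m (∣m⇒∣m*n (prefix (toℕ j)) (d∣e-1 e j)))
      2≤e[_] : ∀ j → 2 ≤ lookup e j
      2≤e[ j ] = lookup⁺ 2≤e j

    -- The successor form makes mⱼ ≥ 1 immediate and lets `μ j ∸ 1` compute to `t * c j`.
    μ : Fin s → ℕ
    μ j = suc (t * c j)

    Y-step : ∀ j → Y (suc (toℕ j)) ≡ Y (toℕ j) * μ j
    Y-step j = Y-unique (suc (toℕ j)) (Y (toℕ j) * μ j) (trans
      (next-y {κ} {d} {t} {w} {Y (toℕ j)} {c = c j} (0<ρ (toℕ j)) (ℕₚ.<⇒≤ 2≤e[ j ]) κd≡tw (exact j) (cYd≡ j))
      (cong (λ ρ → w + κ * (ρ ∸ 1)) (sym (prefix-suc e j))))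

    exact-suc : ∀ j → Exact (suc (toℕ j))
    exact-suc j = Y-exact (suc (toℕ j)) (Y (toℕ j) * μ j) (trans
      (next-y {κ} {d} {t} {w} {Y (toℕ j)} {c = c j} (0<ρ (toℕ j)) (ℕₚ.<⇒≤ 2≤e[ j ]) κd≡tw (exact j) (cYd≡ j))
      (cong (λ ρ → w + κ * (ρ ∸ 1)) (sym (prefix-suc e j))))

    slope : ∀ j → (μ j ∸ 1) * Y (toℕ j) * w ≡ (lookup e j ∸ 1) * prefix (toℕ j) * κ
    slope j = y-slope {κ} {d} {t} {w} {Y (toℕ j)} {c = c j} {e = lookup e j ∸ 1} κd≡tw (cYd≡ j)

    -- If t c were 0, the left side of `slope` would vanish, whereas its right side is positive by
    -- eⱼ ≥ 2 and k > 1.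
    2≤μ : ∀ j → 2 ≤ μ j
    2≤μ j with t * c j | slope j
    ... | zero  | eq = ⊥-elim (ℕₚ.<-irrefl eq (ℕₚ.*-mono-≤ (ℕₚ.*-mono-≤ (ℕₚ.m<n⇒0<n∸m 2≤e[ j ]) (0<ρ (toℕ j))) 0<κ))
    ... | suc _ | _  = s≤s (s≤s z≤n)

    -- From k ≤ v follows w + κ (ρ - 1) ≥ κ ρ: the density y / ρ is at least the slope κ / w. This
    -- is what keeps mⱼ below eⱼ.
    ρκ≤Yw : ∀ j → prefix (toℕ j) * κ ≤ Y (toℕ j) * w
    ρκ≤Yw j with prefix (toℕ j) | 0<ρ (toℕ j) | exact j
    ... | suc ρ | _ | eq = subst (κ + ρ * κ ≤_) (sym eq) (ℕₚ.+-mono-≤ κ≤w (ℕₚ.≤-reflexive (ℕₚ.*-comm ρ κ)))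

    Yw-nonZero : ∀ j → NonZero (Y (toℕ j) * w)
    Yw-nonZero j = >-nonZero (ℕₚ.<-≤-trans (ℕₚ.*-mono-≤ (0<ρ (toℕ j)) 0<κ) (ρκ≤Yw j))

    μ≤e : ∀ j → μ j ≤ lookup e j
    μ≤e j = ℕₚ.≤-trans (s≤s (ℕₚ.*-cancelʳ-≤ (μ j ∸ 1) (lookup e j ∸ 1) (Y (toℕ j) * w) {{Yw-nonZero j}} (begin
      (μ j ∸ 1) * (Y (toℕ j) * w)              ≡⟨ ℕₚ.*-assoc (μ j ∸ 1) (Y (toℕ j)) w ⟨
      (μ j ∸ 1) * Y (toℕ j) * w                ≡⟨ slope j ⟩
      (lookup e j ∸ 1) * prefix (toℕ j) * κ    ≡⟨ ℕₚ.*-assoc (lookup e j ∸ 1) (prefix (toℕ j)) κ ⟩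
      (lookup e j ∸ 1) * (prefix (toℕ j) * κ)  ≤⟨ ℕₚ.*-monoʳ-≤ (lookup e j ∸ 1) (ρκ≤Yw j) ⟩
      (lookup e j ∸ 1) * (Y (toℕ j) * w)       ∎)))
      (ℕₚ.≤-reflexive (ℕₚ.m+[n∸m]≡n (ℕₚ.<⇒≤ 2≤e[ j ])))
      where open ℕₚ.≤-Reasoning

    levels : ∀ j → LevelStep w κ (lookup e j) (μ j) (prefix (toℕ j)) (Y (toℕ j)) (prefix (suc (toℕ j))) (Y (suc (toℕ j)))
    levels j = record
      { 2≤e = 2≤e[ j ] ; 2≤m = 2≤μ j ; 0<ρ = 0<ρ (toℕ j)
      ; ρ′≡ = prefix-suc e j ; η′≡ = Y-step j ; slope = slope j }

    ∏μ≡k : product (tabulate μ) ≡ k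
    ∏μ≡k = begin
      product (tabulate μ)        ≡⟨ ℕₚ.*-identityˡ _ ⟨
      1 * product (tabulate μ)    ≡⟨ cong (_* product (tabulate μ)) Y₀≡1 ⟨
      Y 0 * product (tabulate μ)  ≡⟨ partialProduct-last μ Y Y-step ⟨
      Y s                         ≡⟨ Y-last ⟩
      k                           ∎
      where open ≡-Reasoning

    cofactor-k : ∀ j → cofactor μ j * Y (suc (toℕ j)) ≡ k
    cofactor-k j = trans (ℕₚ.*-comm (cofactor μ j) _) (trans (partialProduct-cofactor μ Y Y-step j)
                     (trans (sym (partialProduct-last μ Y Y-step)) Y-last))

    ratio≡μ : ∀ j → ratio j ≡ ι (μ j)
    ratio≡μ j = ÷-unique (ι (μ j)) {{y≢0 (toℕ j)}} (begin
      y (suc (toℕ j))            ≡⟨ y≡ιY (suc (toℕ j)) (exact-suc j) ⟩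
      ι (Y (suc (toℕ j)))        ≡⟨ cong ι (trans (Y-step j) (ℕₚ.*-comm (Y (toℕ j)) (μ j))) ⟩
      ι (μ j * Y (toℕ j))        ≡⟨ ι-homo-* (μ j) (Y (toℕ j)) ⟨
      ι (μ j) ℚ.* ι (Y (toℕ j))  ≡⟨ cong (ι (μ j) ℚ.*_) (y≡ιY (toℕ j) (exact j)) ⟨
      ι (μ j) ℚ.* y (toℕ j)      ∎)
      where open ≡-Reasoning

    coratio≡cofactor : ∀ j → coratio j ≡ ι (cofactor μ j)
    coratio≡cofactor j = ÷-unique (ι (cofactor μ j)) {{y≢0 (suc (toℕ j))}} (begin
      ι k                                        ≡⟨ cong ι (cofactor-k j) ⟨
      ι (cofactor μ j * Y (suc (toℕ j)))         ≡⟨ ι-homo-* (cofactor μ j) (Y (suc (toℕ j))) ⟨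
      ι (cofactor μ j) ℚ.* ι (Y (suc (toℕ j)))   ≡⟨ cong (ι (cofactor μ j) ℚ.*_) (y≡ιY (suc (toℕ j)) (exact-suc j)) ⟨
      ι (cofactor μ j) ℚ.* y (suc (toℕ j))       ∎)
      where open ≡-Reasoning

    B≐Box : B ≐ Box e μ
    B≐Box = (λ {δ} δ∈ j → Equivalence.to (box j δ) (δ∈ j)) , (λ {δ} δ∈ j → Equivalence.from (box j δ) (δ∈ j))
      where
      box = λ j (δ : Point) → ι≤-1⇔< (toℕ (lookup⁺ δ j)) (μ j) (s≤s z≤n) (ratio≡μ j)

    #blocks : ℕ
    #blocks = product (tabulate λ j → (lookup e j C μ j) ^ cofactor μ j)

    treeCount≡b : treeCount e μ 1 ≡ #blocks
    treeCount≡b = trans (treeCount-product e μ 1)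
      (trans (cong (#blocks *_) (ℕₚ.^-zeroˡ (product (tabulate μ)))) (ℕₚ.*-identityʳ #blocks))

    treesThroughPair : ∀ {p q : Point} → p ≢ q →
      ∃[ n ] (Σ (Tree e μ ⊤) (λ t → Holds (λ _ → ⊤) (treeAt e t p) × Holds (λ _ → ⊤) (treeAt e t q)) ↔ Fin n ×
              n * (v * w) ≡ #blocks * k * κ)
    treesThroughPair {p} {q} p≢q =
      -- The recursion starts with a single label that contains every point, so both shares are 1;
      -- the count for coinciding points is vacuous as `p ≢ q`.
      let n , ↔n , eq = treesThrough e μ prefix Y levels ⊤↔ ⊤×⊤↔ ⊤×⊤↔ (cong (1 *_) (sym Y₀≡1)) p q (λ p≡q → ⊥-elim (p≢q p≡q))
      in n , ↔n , (begin
        n * (v * w)             ≡⟨ ℕₚ.*-assoc n v w ⟨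
        n * v * w               ≡⟨ cong (λ ρ → n * ρ * w) (prefix-last e) ⟨
        n * prefix s * w        ≡⟨ eq ⟩
        treeCount e μ 1 * Y s * κ  ≡⟨ cong₂ (λ x y → x * y * κ) treeCount≡b Y-last ⟩
        #blocks * k * κ               ∎)
      where
      open ≡-Reasoning
      ⊤↔ : ⊤ ↔ Fin 1
      ⊤↔ = mk↔ₛ′ (λ _ → zero) (λ _ → tt) (λ { zero → refl }) (λ _ → refl)
      ⊤×⊤↔ : Σ ⊤ (λ _ → ⊤) ↔ Fin 1
      ⊤×⊤↔ = mk↔ₛ′ (λ _ → zero) (λ _ → tt , tt) (λ { zero → refl }) (λ _ → refl)

    module Design = BoxOrbit e 0<e μ (λ j → ℕₚ.<⇒≤ (2≤μ j)) μ≤e B B≐Box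

    -- Read off at one pair of distinct points. Any other pair satisfies the equation of `Λ-formula`
    -- too, so cancelling v (v - 1) gives the same number.
    Λ : ℕ
    Λ = let _ , _ , p≢q = distinct-points (ℕₚ.<⇒≤ 2≤s) 2≤e in proj₁ (treesThroughPair p≢q)

    Λ-formula : Λ * (v * w) ≡ #blocks * k * κ
    Λ-formula = let _ , _ , p≢q = distinct-points (ℕₚ.<⇒≤ 2≤s) 2≤e in proj₂ (proj₂ (treesThroughPair p≢q))

    block-cardinality : ∀ {X} → (B ^ᴳ Wreath) X → HasCardinality (setoid Point) X k
    block-cardinality {X} X∈ = subst (HasCardinality (setoid Point) X) ∏μ≡k (Design.Block-cardinality X∈)

    is2Design : Is2Design v k Λ (B ^ᴳ Wreath)
    is2Design = record
      { respects  = orbit-respects (Wreath-isGroup e) B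
      ; points    = hasCardinality {S = setoid Point}
          (λ (p , _) → Inverse.to (Point-↔ e) p) (λ i → Inverse.from (Point-↔ e) i , tt)
          (λ { _ _ refl → refl }) (Inverse.strictlyInverseˡ (Point-↔ e)) (λ (p , _) → Inverse.strictlyInverseʳ (Point-↔ e) p)
      ; nonempty  = B , Design.X₀-Block
      ; blockSize = block-cardinality
      ; balanced  = λ {p} {q} p≢q →
          let n , ↔n , eq = treesThroughPair p≢q
          in Design.blocksThrough p q (Fin-cast (ℕₚ.*-cancelʳ-≡ n Λ (v * w) (trans eq (sym Λ-formula))) ↔n)
      }

    design : HasCardinality (setoid Point) B k ×
             IsFlagTransitive Wreath (B ^ᴳ Wreath) ×
             IsChainImprimitive Wreath 𝒞 (B ^ᴳ Wreath) ×
             (∃[ Λ ] ∃[ b ] Is2Design v k Λ (B ^ᴳ Wreath) × BlockFormula b ×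
              + Λ ℚ./ 1 ≡ + (b * k * (k ∸ 1)) ℚ./ (v * (v ∸ 1)))
    design = block-cardinality Design.X₀-Block , Design.flagTransitive , Design.chainImprimitive
           , Λ , #blocks , is2Design , (μ , cofactor μ , ratio≡μ , coratio≡cofactor , refl)
           , ι≡/ Λ (#blocks * k * κ) (v * w) Λ-formula

proposition4p3 : ∀ {s : ℕ} (e : Vec ℕ s) (k : ℕ)
    (2≤s : 2 ≤ s) (2≤e : All (2 ≤_) e) (1<k : 1 < k) (k<v : k < Chain.v e) →
    let open Construction e k 2≤s 2≤e 1<k k<v in
    (v ∸ 1) ∣ ((k ∸ 1) * d) →
    (∀ (i : Fin s) → 1 ≤ toℕ i →
    y (toℕ i) IsIntegerDividing (((lookup e i ∸ 1) * prefix (toℕ i)) / d)) →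
    HasCardinality (setoid Point) B k ×
    IsFlagTransitive Wreath (B ^ᴳ Wreath) ×
    IsChainImprimitive Wreath 𝒞 (B ^ᴳ Wreath) ×
    (∃[ Λ ] ∃[ b ]
    Is2Design v k Λ (B ^ᴳ Wreath) ×
    BlockFormula b ×
    + Λ /ℚ 1 ≡ + (b * k * (k ∸ 1)) /ℚ (v * (v ∸ 1)))
proposition4p3 e k 2≤s 2≤e 1<k k<v = Parameters.design e k 2≤s 2≤e 1<k k<v
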